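{- Let $S$ be a numerical semigroup with some nonzero $a\in S$, let $m$ be a positive integer, and suppose $\mathrm{Ap}(S;a)\setminus\{0\}$ is an arithmetic sequence consisting of at least one term. Then $S=\langle \{a\}\cup\{ha+id:1\le i\le a-1\}\rangle$ for some integers $a\ge2$, $h\ge0$, $d\ge1$ with $\gcd(a,d)=1$ (where, if $a=2$, one takes $h=0$ and $d$ odd). Moreover, $\mathrm{H}(S)$ is equidistributed modulo $m$ if and only if $\gcd(ad,m)=1$ and at least one of the following occurs: (1) $a\equiv1\pmod m$; or (2) $a\equiv2\pmod m$ and $2h+d\equiv1\pmod m$; or (3) $d\equiv1\pmod m$ and $h\equiv0\pmod m$; or (4) $d\equiv-1\pmod m$ and $h\equiv1\pmod m$.
   Context: A numerical semigroup is a submonoid $S$ of $(\mathbb{N}_0,+)$ with finite complement; $\mathrm{H}(S)=\mathbb{N}_0\setminus S$ is its set of gaps. For $G\subset\mathbb{N}_0$, $\langle G\rangle$ is the set of all finite $\mathbb{N}_0$-linear combinations of elements of $G$. For nonzero $a\in S$, the Apéry set is $\mathrm{Ap}(S;a)=\{s\in S: s-a\notin S\}$; it has exactly $a$ elements. "$\mathrm{Ap}(S;a)\setminus\{0\}$ is an arithmetic sequence" means that this set equals $\{\beta+\delta,\beta+2\delta,\dots,\beta+(a-1)\delta\}$ for some $\beta\in\mathbb{Z}$ and some positive integer $\delta$; when $a=2$ the convention is $\beta=0$ and $\delta$ odd. The parameters in the representation of $S$ correspond to $\beta=ha$ and $\delta=d$. A finite (multi)set of integers is equidistributed modulo $m$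 if it contains the same number of elements in each congruence class modulo $m$.
   Formalization: The equivalence is stated only for H(S) nonempty, i.e. S ≠ ℕ₀: for S = ℕ₀, a = 2, h = 0, d = 1, m = 2 the empty gap set is equidistributed but gcd(ad,m) = 2. S comes with decidable membership and a list of its gaps (automatic classically). -}

module Defs where

open import Data.Integer as ℤ using (ℤ; +_)
open import Data.Integer.Divisibility as ℤ using ()
open import Data.List using (List; filter; length; map)
open import Data.List.Membership.Propositional using () renaming (_∈_ to _∈ₗ_)
open import Data.List.Relation.Unary.All using (All)
open import Data.List.Relation.Unary.Unique.Propositional using (Unique)
open import Data.Nat using (ℕ; _+_; _*_; _≤_; _<_; _≟_; NonZero)
open import Data.Nat.DivMod using (_%_)
open import Data.Nat.ListAction using (sum)
open import Data.Product using (∃; ∃-syntax; _×_; proj₂; uncurry)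
open import Function using (_∘_; _⇔_)
open import Level using (0ℓ)
open import Relation.Binary.PropositionalEquality using (_≡_)
open import Relation.Unary using (Pred; Decidable; ∁; _∈_; _∉_; _∪_; _≐_; ｛_｝)

-- `gaps` lists every element of the complement exactly once (in no
-- prescribed order).  Decidable membership is automatic classically;
-- constructively it is part of what it means to be given S.
record NumericalSemigroup : Set₁ where
  field
    member   : Pred ℕ 0ℓ
    member?  : Decidable member
    0∈       : 0 ∈ member
    +-closed : ∀ {x y} → x ∈ member → y ∈ member → x + y ∈ member
    gaps     : List ℕ
    unique   : Unique gaps
    gaps⇔    : ∀ n → n ∈ₗ gaps ⇔ n ∈ ∁ member

open NumericalSemigroup public

H : NumericalSemigroup → List ℕ
H = gaps

-- ⟨ G ⟩: a list of pairs (c , g) stands for the linear combination Σ c * g.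
⟨_⟩ : Pred ℕ 0ℓ → Pred ℕ 0ℓ
⟨ G ⟩ n = ∃[ cs ] All (G ∘ proj₂) cs × sum (map (uncurry _*_) cs) ≡ n

-- A subset of ℕ viewed as a subset of ℤ.
embed : Pred ℕ 0ℓ → Pred ℤ 0ℓ
embed P z = ∃[ n ] P n × z ≡ + n

-- The difference s - a is taken in ℤ: truncated subtraction would send
-- every s < a to 0 ∈ S.
Ap : NumericalSemigroup → ℕ → Pred ℕ 0ℓ
Ap S a s = s ∈ member S × (+ s ℤ.- + a) ∉ embed (member S)

Ap∖0 : NumericalSemigroup → ℕ → Pred ℕ 0ℓ
Ap∖0 S a s = s ∈ Ap S a × s ∉ ｛ 0 ｝

Odd : ℕ → Set
Odd n = n % 2 ≡ 1

-- The set {β + δ , β + 2δ , … , β + (a - 1)δ}.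
progression : ℤ → ℕ → ℕ → Pred ℤ 0ℓ
progression β δ a z = ∃[ i ] 1 ≤ i × i < a × z ≡ β ℤ.+ + (i * δ)

-- For a = 2 a one-term sequence does not determine β and δ; the last
-- component is the normalisation fixing them.
IsArithmetic : NumericalSemigroup → ℕ → ℤ → ℕ → Set
IsArithmetic S a β δ =
  1 ≤ δ ×
  embed (Ap∖0 S a) ≐ progression β δ a ×
  (a ≡ 2 → β ≡ + 0 × Odd δ)

generators : ℕ → ℕ → ℕ → Pred ℕ 0ℓ
generators a h d = ｛ a ｝ ∪ λ x → ∃[ i ] 1 ≤ i × i < a × x ≡ h * a + i * d

countMod : (m : ℕ) .{{_ : NonZero m}} → ℕ → List ℕ → ℕ
countMod m r xs = length (filter (λ x → x % m ≟ r) xs)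

-- A finite multiset is given as a list, and the congruence classes modulo m
-- by their least residues.
Equidistributed : (m : ℕ) .{{_ : NonZero m}} → List ℕ → Set
Equidistributed m xs =
  ∀ r s → r < m → s < m → countMod m r xs ≡ countMod m s xs

infix 4 _≡_[mod_]

_≡_[mod_] : ℤ → ℤ → ℕ → Set
x ≡ y [mod m ] = (+ m) ℤ.∣ (x ℤ.- y)

{-# OPTIONS --safe #-}
module Submission where

-- Removing from H(S) ∪ Ap(S; a) the interval {0, …, a - 1} leaves the translate
-- H(S) + a.  Summing a function f over these multisets relates the sums of
-- f (x + a) - f x over the gaps to those of f over the Apéry set and the interval.
-- * For f of period m the gap terms cancel when H(S) is equidistributed, so that
--   Ap(S; a) and {0, …, a - 1} agree modulo m; if gcd(a, m) = 1 the converse holds,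
--   as a sum over the gaps that is invariant under a and m is invariant under 1.
-- * For f x = x φ(x) with φ even of period a, reflecting i ↦ a - i gives
--   2 Σ_H φ = (2h + d - 1) Σ_{0<i<a} φ(i).  Taking φ = 1 and φ = [g ∣ x] with
--   g = gcd(a, m), equidistribution forces g = 1 unless H(S) is empty.
-- * An arithmetic progression modulo m is an interval only in the listed cases:
--   translating it by its step d moves a single point, while translating an interval
--   by d ≢ 0, ±1 moves at least two unless it is short or its complement is.

open import Defs
open import Data.Bool using (true; false; if_then_else_)
open import Data.Integer as ℤ using (ℤ)
import Data.Integer.Coprimality as ℤ
import Data.Integer.Divisibility as ℤ
import Data.Integer.Divisibility.Signed as Signed
import Data.Integer.Properties as ℤ
import Data.Integer.Tactic.RingSolver as ℤSolver
open import Data.List using (List; []; _∷_; _++_; map; filter; length; upTo; _∷ʳ_)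
open import Data.List.Membership.Propositional using () renaming (_∈_ to _∈ₗ_)
open import Data.List.Membership.Propositional.Properties
  using (∈-upTo⁺; ∈-upTo⁻; ∈-map⁺; ∈-map⁻; ∈-++⁺ˡ; ∈-++⁺ʳ; ∈-++⁻)
open import Data.List.Membership.Propositional.Properties.WithK using (unique∧set⇒bag)
open import Data.List.Properties using (map-++; map-∘; map-upTo; map-applyUpTo; upTo-∷ʳ)
open import Data.List.Relation.Binary.BagAndSetEquality using (∼bag⇒↭)
open import Data.List.Relation.Binary.Permutation.Propositional using (_↭_)
import Data.List.Relation.Binary.Permutation.Propositional.Properties as Perm
open import Data.List.Relation.Unary.All as All using (All; []; _∷_)
open import Data.List.Relation.Unary.AllPairs using (_∷_)
open import Data.List.Relation.Unary.Any using (here; there)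
open import Data.List.Relation.Unary.Unique.Propositional using (Unique)
import Data.List.Relation.Unary.Unique.Propositional.Properties as Unique
open import Data.Nat
open import Data.Nat.Coprimality as Coprime using (Coprime; coprime-Bézout; gcd≡1⇒coprime)
open import Data.Nat.Divisibility
  using (_∣_; divides; ∣-refl; ∣-trans; ∣1⇒≡1; ∣m⇒∣m*n; ∣n⇒∣m*n; ∣m+n∣m⇒∣n; n∣m*n; m%n≡0⇒n∣m; n∣m⇒m%n≡0)
open import Data.Nat.DivMod
open import Data.Nat.GCD
  using (gcd; gcd[m,n]∣m; gcd[m,n]∣n; gcd[m,n]≢0; gcd-greatest; gcd-comm; gcd-zeroʳ; module Bézout)
open import Data.Nat.Induction using (<-rec)
open import Data.Nat.ListAction using (sum)
open import Data.Nat.ListAction.Properties using (sum-++; sum-↭)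
open import Data.Nat.Properties
open import Data.Nat.Tactic.RingSolver using (solve-∀)
open import Data.Product using (∃-syntax; _×_; _,_; proj₁; proj₂; uncurry)
open import Data.Sum using (_⊎_; inj₁; inj₂)
open import Function using (_∘_; _⇔_; mk⇔; Equivalence)
open import Relation.Binary.PropositionalEquality
open import Relation.Nullary using (¬_; does; yes; no; contradiction)
open import Relation.Nullary.Decidable using (dec-false)
open import Relation.Unary using (_∈_; _≐_; Satisfiable)
open Equivalence using (to; from)
open ≤-Reasoning

-- Finite sums over lists and initial intervals

∑ : List ℕ → (ℕ → ℕ) → ℕ
∑ xs f = sum (map f xs)

syntax ∑ xs (λ x → e) = ∑[ x ← xs ] e

∑-cong : ∀ {f g} xs → (∀ {x} → x ∈ₗ xs → f x ≡ g x) → ∑ xs f ≡ ∑ xs g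
∑-cong []       f≗g = refl
∑-cong (x ∷ xs) f≗g = cong₂ _+_ (f≗g (here refl)) (∑-cong xs (f≗g ∘ there))

∑-cong-all : ∀ {f g} xs → (∀ x → f x ≡ g x) → ∑ xs f ≡ ∑ xs g
∑-cong-all xs f≗g = ∑-cong xs (λ {x} _ → f≗g x)

∑-cong-< : ∀ {f g} n → (∀ {i} → i < n → f i ≡ g i) → ∑ (upTo n) f ≡ ∑ (upTo n) g
∑-cong-< n f≗g = ∑-cong (upTo n) (f≗g ∘ ∈-upTo⁻)

∑-+ : ∀ xs f g → ∑[ x ← xs ] (f x + g x) ≡ ∑ xs f + ∑ xs g
∑-+ []       f g = refl
∑-+ (x ∷ xs) f g = begin-equality
  f x + g x + ∑[ y ← xs ] (f y + g y) ≡⟨ cong (f x + g x +_) (∑-+ xs f g) ⟩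
  f x + g x + (∑ xs f + ∑ xs g)       ≡⟨ interchange (f x) (g x) (∑ xs f) (∑ xs g) ⟩
  f x + ∑ xs f + (g x + ∑ xs g)       ∎
  where
  interchange : ∀ a b c d → a + b + (c + d) ≡ a + c + (b + d)
  interchange = solve-∀

∑-*ˡ : ∀ xs c f → ∑[ x ← xs ] (c * f x) ≡ c * ∑ xs f
∑-*ˡ []       c f = sym (*-zeroʳ c)
∑-*ˡ (x ∷ xs) c f =
  trans (cong (c * f x +_) (∑-*ˡ xs c f)) (sym (*-distribˡ-+ c (f x) (∑ xs f)))

∑-const : ∀ xs c → ∑[ _ ← xs ] c ≡ length xs * c
∑-const []       c = refl
∑-const (x ∷ xs) c = cong (c +_) (∑-const xs c)

∑-swap : ∀ xs ys (f : ℕ → ℕ → ℕ) →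
         ∑[ x ← xs ] (∑[ y ← ys ] f x y) ≡ ∑[ y ← ys ] (∑[ x ← xs ] f x y)
∑-swap []       ys f = sym (trans (∑-const ys 0) (*-zeroʳ (length ys)))
∑-swap (x ∷ xs) ys f = begin-equality
  ∑ ys (f x) + ∑[ x ← xs ] (∑ ys (f x))        ≡⟨ cong (∑ ys (f x) +_) (∑-swap xs ys f) ⟩
  ∑ ys (f x) + ∑[ y ← ys ] (∑[ x ← xs ] f x y) ≡⟨ ∑-+ ys (f x) _ ⟨
  ∑[ y ← ys ] (∑[ x ← x ∷ xs ] f x y)          ∎

∑-++ : ∀ xs ys f → ∑ (xs ++ ys) f ≡ ∑ xs f + ∑ ys f
∑-++ xs ys f = trans (cong sum (map-++ f xs ys)) (sum-++ (map f xs) (map f ys))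

∑-map : ∀ xs (g f : ℕ → ℕ) → ∑ (map g xs) f ≡ ∑ xs (f ∘ g)
∑-map xs g f = cong sum (sym (map-∘ xs))

∑-↭ : ∀ {xs ys} f → xs ↭ ys → ∑ xs f ≡ ∑ ys f
∑-↭ f = sum-↭ ∘ Perm.map⁺ f

∑-first : ∀ n f → ∑ (upTo (suc n)) f ≡ f 0 + ∑ (upTo n) (f ∘ suc)
∑-first n f = cong (λ l → f 0 + sum l) (trans (map-applyUpTo suc f n) (sym (map-upTo (f ∘ suc) n)))

∑-last : ∀ n f → ∑ (upTo (suc n)) f ≡ ∑ (upTo n) f + f n
∑-last n f = begin-equality
  ∑ (upTo (suc n)) f        ≡⟨ cong (λ l → ∑ l f) (upTo-∷ʳ n) ⟨
  ∑ (upTo n ∷ʳ n) f         ≡⟨ ∑-++ (upTo n) (n ∷ []) f ⟩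
  ∑ (upTo n) f + (f n + 0)  ≡⟨ cong (∑ (upTo n) f +_) (+-identityʳ (f n)) ⟩
  ∑ (upTo n) f + f n        ∎

∑-telescope : ∀ n (f : ℕ → ℕ) → f 0 + ∑ (upTo n) (f ∘ suc) ≡ ∑ (upTo n) f + f n
∑-telescope n f = trans (sym (∑-first n f)) (∑-last n f)

∑-upTo-+ : ∀ k r f → ∑ (upTo (k + r)) f ≡ ∑ (upTo k) f + ∑[ i ← upTo r ] f (k + i)
∑-upTo-+ zero    r f = refl
∑-upTo-+ (suc k) r f = begin-equality
  ∑ (upTo (suc (k + r))) f                                            ≡⟨ ∑-first (k + r) f ⟩
  f 0 + ∑ (upTo (k + r)) (f ∘ suc)
    ≡⟨ cong (f 0 +_) (∑-upTo-+ k r (f ∘ suc)) ⟩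
  f 0 + (∑ (upTo k) (f ∘ suc) + ∑[ i ← upTo r ] f (suc k + i))        ≡⟨ +-assoc (f 0) _ _ ⟨
  f 0 + ∑ (upTo k) (f ∘ suc) + ∑[ i ← upTo r ] f (suc k + i)
    ≡⟨ cong (_+ ∑[ i ← upTo r ] f (suc k + i)) (∑-first k f) ⟨
  ∑ (upTo (suc k)) f + ∑[ i ← upTo r ] f (suc k + i)                  ∎

∑-upTo-const : ∀ n c → ∑[ _ ← upTo n ] c ≡ n * c
∑-upTo-const zero    c = refl
∑-upTo-const (suc n) c = trans (∑-first n (λ _ → c)) (cong (c +_) (∑-upTo-const n c))

∑-zero : ∀ n {f} → (∀ {i} → i < n → f i ≡ 0) → ∑ (upTo n) f ≡ 0
∑-zero n f≗0 = trans (∑-cong-< n f≗0) (trans (∑-upTo-const n 0) (*-zeroʳ n))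

-- The first term of `f` is matched with the last of `g`. Writing the reflected index as a `j` with
-- `suc (i + j) ≡ n` avoids truncated subtraction.
∑-reflect : ∀ n {f g} → (∀ i j → suc (i + j) ≡ n → f i ≡ g j) → ∑ (upTo n) f ≡ ∑ (upTo n) g
∑-reflect zero            f~g = refl
∑-reflect (suc n) {f} {g} f~g = begin-equality
  ∑ (upTo (suc n)) f           ≡⟨ ∑-first n f ⟩
  f 0 + ∑ (upTo n) (f ∘ suc)
    ≡⟨ cong₂ _+_ (f~g 0 n refl) (∑-reflect n (λ i j eq → f~g (suc i) j (cong suc eq))) ⟩
  g n + ∑ (upTo n) g           ≡⟨ +-comm (g n) _ ⟩
  ∑ (upTo n) g + g n           ≡⟨ ∑-last n g ⟨
  ∑ (upTo (suc n)) g           ∎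

-- Gauss pairing: adding the sum to its reflection gives every index the weight `x i + x j`, which
-- is t. The reflected weight is written `t ∸ x i`, where `x≤t` ensures that nothing is truncated.
∑-reflect-weighted : ∀ n (x φ : ℕ → ℕ) {t} →
  (∀ i j → suc (i + j) ≡ n → x i + x j ≡ t) →
  (∀ i j → suc (i + j) ≡ n → φ i ≡ φ j) →
  2 * ∑[ i ← upTo n ] (x i * φ i) ≡ t * ∑ (upTo n) φ
∑-reflect-weighted n x φ {t} x+x≡t φ≡φ = begin-equality
  2 * ∑ (upTo n) xφ                         ≡⟨ cong (∑ (upTo n) xφ +_) (+-identityʳ _) ⟩
  ∑ (upTo n) xφ + ∑ (upTo n) xφ             ≡⟨ cong (∑ (upTo n) xφ +_) (∑-reflect n reflect) ⟩
  ∑ (upTo n) xφ + ∑ (upTo n) x′φ            ≡⟨ ∑-+ (upTo n) xφ x′φ ⟨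
  ∑[ i ← upTo n ] (xφ i + x′φ i)
    ≡⟨ ∑-cong-< n (λ {i} i<n → trans (sym (*-distribʳ-+ (φ i) (x i) (t ∸ x i)))
         (cong (_* φ i) (m+[n∸m]≡n (x≤t i<n)))) ⟩
  ∑[ i ← upTo n ] (t * φ i)                 ≡⟨ ∑-*ˡ (upTo n) t φ ⟩
  t * ∑ (upTo n) φ                          ∎
  where
  xφ x′φ : ℕ → ℕ
  xφ  i = x i * φ i
  x′φ i = (t ∸ x i) * φ i
  reflect : ∀ i j → suc (i + j) ≡ n → xφ i ≡ x′φ j
  reflect i j eq = cong₂ _*_
    (trans (sym (m+n∸n≡m (x i) (x j))) (cong (_∸ x j) (x+x≡t i j eq))) (φ≡φ i j eq)
  x≤t : ∀ {i} → i < n → x i ≤ t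
  x≤t {i} i<n with j , eq ← m≤n⇒∃[o]m+o≡n i<n =
    subst (x i ≤_) (x+x≡t i j eq) (m≤m+n (x i) (x j))

∑-term : ∀ n f {i} → i < n → f i ≤ ∑ (upTo n) f
∑-term (suc n) f {zero}  _         = ≤-trans (m≤m+n (f 0) _) (≤-reflexive (sym (∑-first n f)))
∑-term (suc n) f {suc i} (s≤s i<n) =
  ≤-trans (∑-term n (f ∘ suc) i<n) (≤-trans (m≤n+m _ (f 0)) (≤-reflexive (sym (∑-first n f))))

∑-two-terms : ∀ n f {i} → suc i < n → f i + f (suc i) ≤ ∑ (upTo n) f
∑-two-terms (suc n) f {zero}  (s≤s 0<n) =
  ≤-trans (+-monoʳ-≤ (f 0) (∑-term n (f ∘ suc) 0<n)) (≤-reflexive (sym (∑-first n f)))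
∑-two-terms (suc n) f {suc i} (s≤s i<n) =
  ≤-trans (∑-two-terms n (f ∘ suc) i<n) (≤-trans (m≤n+m _ (f 0)) (≤-reflexive (sym (∑-first n f))))

-- Indicator functions and counting

χ : ℕ → ℕ → ℕ
χ x y = if does (x ≟ y) then 1 else 0

χ-refl : ∀ x → χ x x ≡ 1
χ-refl zero    = refl
χ-refl (suc x) = χ-refl x

χ-≢ : ∀ {x y} → x ≢ y → χ x y ≡ 0
χ-≢ {x} {y} x≢y = cong (if_then 1 else 0) (dec-false (x ≟ y) x≢y)

1≤χ⇒≡ : ∀ x y → 1 ≤ χ x y → x ≡ y
1≤χ⇒≡ zero    zero    _   = refl
1≤χ⇒≡ (suc x) (suc y) 1≤χ = cong suc (1≤χ⇒≡ x y 1≤χ)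

χ-sym : ∀ x y → χ x y ≡ χ y x
χ-sym zero    zero    = refl
χ-sym zero    (suc y) = refl
χ-sym (suc x) zero    = refl
χ-sym (suc x) (suc y) = χ-sym x y

-- Expands a value of `f` over all residues, so that sums over a list can be regrouped by class.
∑-χ : ∀ n (f : ℕ → ℕ) {t} → t < n → ∑[ r ← upTo n ] (f r * χ t r) ≡ f t
∑-χ (suc n) f {zero}  _ = begin-equality
  ∑[ r ← upTo (suc n) ] (f r * χ 0 r)                      ≡⟨ ∑-first n (λ r → f r * χ 0 r) ⟩
  f 0 * 1 + ∑[ r ← upTo n ] (f (suc r) * 0)
    ≡⟨ cong₂ _+_ (*-identityʳ (f 0)) (∑-zero n (λ {r} _ → *-zeroʳ (f (suc r)))) ⟩
  f 0 + 0                                    ≡⟨ +-identityʳ (f 0) ⟩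
  f 0                                        ∎
∑-χ (suc n) f {suc t} (s≤s t<n) = begin-equality
  ∑[ r ← upTo (suc n) ] (f r * χ (suc t) r)          ≡⟨ ∑-first n (λ r → f r * χ (suc t) r) ⟩
  f 0 * 0 + ∑[ r ← upTo n ] (f (suc r) * χ t r)      ≡⟨ cong₂ _+_ (*-zeroʳ (f 0)) (∑-χ n (f ∘ suc) t<n) ⟩
  f (suc t)                                          ∎

∑-mod-χ : ∀ m .{{_ : NonZero m}} {r} → r < m → ∑[ j ← upTo m ] χ (j % m) r ≡ 1
∑-mod-χ m {r} r<m = begin-equality
  ∑[ j ← upTo m ] χ (j % m) r
    ≡⟨ ∑-cong-< m (λ {j} j<m →
         trans (cong (λ x → χ x r) (m<n⇒m%n≡m j<m)) (trans (χ-sym j r) (sym (*-identityˡ _)))) ⟩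
  ∑[ j ← upTo m ] (1 * χ r j)   ≡⟨ ∑-χ m (λ _ → 1) r<m ⟩
  1                             ∎

-- `filter` and `χ` branch on the same Boolean, so one case split evaluates both sides.
length-filter : ∀ (g : ℕ → ℕ) r xs → length (filter (λ x → g x ≟ r) xs) ≡ ∑[ x ← xs ] χ (g x) r
length-filter g r []       = refl
length-filter g r (x ∷ xs) with does (g x ≟ r)
... | true  = cong suc (length-filter g r xs)
... | false = length-filter g r xs

-- Periodic functions and equidistribution

Periodic : ℕ → (ℕ → ℕ) → Set
Periodic p f = ∀ x → f (x + p) ≡ f x

module _ {p f} (f-p : Periodic p f) where

  periodic-* : ∀ k → Periodic (k * p) f
  periodic-* zero    x = cong f (+-identityʳ x)
  periodic-* (suc k) x = begin-equality
    f (x + (p + k * p)) ≡⟨ cong f (sym (+-assoc x p (k * p))) ⟩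
    f (x + p + k * p)   ≡⟨ periodic-* k (x + p) ⟩
    f (x + p)           ≡⟨ f-p x ⟩
    f x                 ∎

  periodic-∣ : ∀ {q} → p ∣ q → Periodic q f
  periodic-∣ (divides k refl) = periodic-* k

  periodic-∘+ : ∀ c → Periodic p (λ x → f (x + c))
  periodic-∘+ c x = begin-equality
    f (x + p + c)   ≡⟨ cong f (+-assoc x p c) ⟩
    f (x + (p + c)) ≡⟨ cong (λ y → f (x + y)) (+-comm p c) ⟩
    f (x + (c + p)) ≡⟨ cong f (+-assoc x c p) ⟨
    f (x + c + p)   ≡⟨ f-p (x + c) ⟩
    f (x + c)       ∎

periodic-1⇒constant : ∀ {f} → Periodic 1 f → ∀ x y → f x ≡ f y
periodic-1⇒constant {f} f-1 x y = trans (to-0 x) (sym (to-0 y))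
  where
  to-0 : ∀ x → f x ≡ f 0
  to-0 x = trans (cong f (sym (*-identityʳ x))) (periodic-* f-1 x 0)

-- A Bézout relation writes 1 as a multiple of one period minus a multiple of the other, so `f` has
-- period 1.
periodic-coprime : ∀ {p q f} → gcd p q ≡ 1 → Periodic p f → Periodic q f → ∀ x y → f x ≡ f y
periodic-coprime {p} {q} {f} gcd≡1 f-p f-q = periodic-1⇒constant f-1
  where
  f-1 : Periodic 1 f
  f-1 x with coprime-Bézout (gcd≡1⇒coprime {p} {q} gcd≡1)
  ... | Bézout.+- k l eq = begin-equality
    f (x + 1)           ≡⟨ periodic-* f-q l (x + 1) ⟨
    f (x + 1 + l * q)   ≡⟨ cong f (trans (+-assoc x 1 _) (cong (x +_) eq)) ⟩
    f (x + k * p)       ≡⟨ periodic-* f-p k x ⟩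
    f x                 ∎
  ... | Bézout.-+ k l eq = begin-equality
    f (x + 1)           ≡⟨ periodic-* f-p k (x + 1) ⟨
    f (x + 1 + k * p)   ≡⟨ cong f (trans (+-assoc x 1 _) (cong (x +_) eq)) ⟩
    f (x + l * q)       ≡⟨ periodic-* f-q l x ⟩
    f x                 ∎

∑-periodic : ∀ {p} xs {g : ℕ → ℕ → ℕ} → (∀ x → Periodic p (λ y → g y x)) →
             Periodic p (λ y → ∑ xs (g y))
∑-periodic xs g-p y = ∑-cong-all xs (λ x → g-p x y)

mod-periodic : ∀ m .{{_ : NonZero m}} (f : ℕ → ℕ) → Periodic m (λ x → f (x % m))
mod-periodic m f x = cong f ([m+n]%n≡m%n x m)

-- Over a whole number of periods an arithmetic progression with step coprime
-- to the period sums to the same value as an interval: both sums do not depend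
-- on the starting point, so averaging one over the other identifies them.
∑-cycle : ∀ {m k d f} → gcd m d ≡ 1 → m ∣ k → Periodic m f →
          ∀ x y → ∑[ i ← upTo k ] f (x + i * d) ≡ ∑[ i ← upTo k ] f (y + i)
∑-cycle {m} {zero}      {d} {f} m⊥d m∣k f-m x y = refl
∑-cycle {m} {k@(suc _)} {d} {f} m⊥d m∣k f-m x y = *-cancelˡ-≡ _ _ k (begin-equality
  k * F x                                              ≡⟨ ∑-upTo-const k (F x) ⟨
  ∑[ _ ← upTo k ] F x                                  ≡⟨ ∑-cong-all (upTo k) (λ j → F-constant x (0 + j)) ⟩
  ∑[ j ← upTo k ] (∑[ i ← upTo k ] f (j + i * d))      ≡⟨ ∑-swap (upTo k) (upTo k) _ ⟩
  ∑[ i ← upTo k ] (∑[ j ← upTo k ] f (j + i * d))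
    ≡⟨ ∑-cong-all (upTo k) (λ i → ∑-cong-all (upTo k) (λ j →
         cong f (trans (+-comm j (i * d)) (cong (i * d +_) (sym (*-identityʳ j)))))) ⟩
  ∑[ i ← upTo k ] G (i * d)                            ≡⟨ ∑-cong-all (upTo k) (λ i → G-constant (i * d) y) ⟩
  ∑[ _ ← upTo k ] G y                                  ≡⟨ ∑-upTo-const k (G y) ⟩
  k * G y
    ≡⟨ cong (k *_) (∑-cong-all (upTo k) (λ i → cong (λ z → f (y + z)) (*-identityʳ i))) ⟩
  k * ∑[ i ← upTo k ] f (y + i)                        ∎)
  where
  progression-sum : ℕ → ℕ → ℕ
  progression-sum e z = ∑[ i ← upTo k ] f (z + i * e)

  -- Translation by the step drops the first term and adds `f (z + k * e)`, which equals `f z`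
  -- because m divides k.
  step-periodic : ∀ e → Periodic e (progression-sum e)
  step-periodic e z = +-cancelˡ-≡ (f z) _ _ (begin-equality
    f z + ∑[ i ← upTo k ] f (z + e + i * e)
      ≡⟨ cong₂ _+_ (cong f (sym (+-identityʳ z))) (∑-cong-all (upTo k) (λ i → cong f (+-assoc z e (i * e)))) ⟩
    f (z + 0) + ∑[ i ← upTo k ] f (z + suc i * e)   ≡⟨ ∑-telescope k (λ i → f (z + i * e)) ⟩
    progression-sum e z + f (z + k * e)
      ≡⟨ cong (progression-sum e z +_)
           (trans (cong (λ w → f (z + w)) (*-comm k e)) (periodic-* (periodic-∣ f-m m∣k) e z)) ⟩
    progression-sum e z + f z                       ≡⟨ +-comm _ (f z) ⟩
    f z + progression-sum e z                       ∎)

  period : ∀ e → Periodic m (progression-sum e)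
  period e = ∑-periodic (upTo k) (λ i → periodic-∘+ f-m (i * e))

  F G : ℕ → ℕ
  F = progression-sum d
  G = progression-sum 1

  F-constant : ∀ x y → F x ≡ F y
  F-constant = periodic-coprime m⊥d (period d) (step-periodic d)

  G-constant : ∀ x y → G x ≡ G y
  G-constant = periodic-1⇒constant (step-periodic 1)

∑-periods : ∀ {m f} → Periodic m f → ∀ q → ∑ (upTo (q * m)) f ≡ q * ∑ (upTo m) f
∑-periods         f-m zero    = refl
∑-periods {m} {f} f-m (suc q) = begin-equality
  ∑ (upTo (m + q * m)) f                              ≡⟨ ∑-upTo-+ m (q * m) f ⟩
  ∑ (upTo m) f + ∑[ i ← upTo (q * m) ] f (m + i)
    ≡⟨ cong (∑ (upTo m) f +_) (∑-cong-all (upTo (q * m)) (λ i → trans (cong f (+-comm m i)) (f-m i))) ⟩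
  ∑ (upTo m) f + ∑ (upTo (q * m)) f                   ≡⟨ cong (∑ (upTo m) f +_) (∑-periods f-m q) ⟩
  ∑ (upTo m) f + q * ∑ (upTo m) f                     ∎

∑-interval : ∀ {m k f} → m ∣ k → Periodic m f →
             ∀ x y → ∑[ i ← upTo k ] f (x + i) ≡ ∑[ i ← upTo k ] f (y + i)
∑-interval {m} {f = f} m∣k f-m x y =
  trans (sym (∑-cycle {f = f} (gcd-zeroʳ m) m∣k f-m 0 x)) (∑-cycle {f = f} (gcd-zeroʳ m) m∣k f-m 0 y)

periodic-% : ∀ {m f} .{{_ : NonZero m}} → Periodic m f → ∀ x → f x ≡ f (x % m)
periodic-% {m} {f} f-m x = trans (cong f (m≡m%n+[m/n]*n x m)) (periodic-* f-m (x / m) (x % m))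

module _ (m : ℕ) .{{_ : NonZero m}} (xs : List ℕ) where

  countMod≡∑ : ∀ r → countMod m r xs ≡ ∑[ x ← xs ] χ (x % m) r
  countMod≡∑ r = length-filter (_% m) r xs

  -- Group the list by residue class: each value `f r` is taken as often as `f 0`, since all classes
  -- have the count of class 0.
  equidistributed⇒∑ : Equidistributed m xs → ∀ {f} → Periodic m f →
                      ∑ xs f ≡ countMod m 0 xs * ∑ (upTo m) f
  equidistributed⇒∑ equi {f} f-m = begin-equality
    ∑ xs f
      ≡⟨ ∑-cong-all xs (λ x → trans (periodic-% f-m x) (sym (∑-χ m f (m%n<n x m)))) ⟩
    ∑[ x ← xs ] (∑[ r ← upTo m ] (f r * χ (x % m) r))          ≡⟨ ∑-swap xs (upTo m) _ ⟩
    ∑[ r ← upTo m ] (∑[ x ← xs ] (f r * χ (x % m) r))          ≡⟨ ∑-cong-< m class-sum ⟩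
    ∑[ r ← upTo m ] (countMod m 0 xs * f r)                    ≡⟨ ∑-*ˡ (upTo m) (countMod m 0 xs) f ⟩
    countMod m 0 xs * ∑ (upTo m) f                             ∎
    where
    class-sum : ∀ {r} → r < m → ∑[ x ← xs ] (f r * χ (x % m) r) ≡ countMod m 0 xs * f r
    class-sum {r} r<m = begin-equality
      ∑[ x ← xs ] (f r * χ (x % m) r)   ≡⟨ ∑-*ˡ xs (f r) _ ⟩
      f r * ∑[ x ← xs ] χ (x % m) r     ≡⟨ cong (f r *_) (countMod≡∑ r) ⟨
      f r * countMod m r xs             ≡⟨ cong (f r *_) (equi r 0 r<m (>-nonZero⁻¹ m)) ⟩
      f r * countMod m 0 xs             ≡⟨ *-comm (f r) _ ⟩
      countMod m 0 xs * f r             ∎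

  -- Average over m consecutive translates: exchanging the sums turns the inner one into a sum over
  -- a full period, so m times the sum over `xs` depends on `xs` only through its length. The
  -- indicators of the classes then give equal counts.
  shift-invariant⇒equidistributed :
    (∀ {f} → Periodic m f → Periodic 1 (λ y → ∑[ x ← xs ] f (x + y))) → Equidistributed m xs
  shift-invariant⇒equidistributed invariant r s r<m s<m =
    *-cancelˡ-≡ _ _ m (trans (m*count r<m) (sym (m*count s<m)))
    where
    m*∑ : ∀ {f} → Periodic m f → m * ∑ xs f ≡ length xs * ∑ (upTo m) f
    m*∑ {f} f-m = begin-equality
      m * ∑ xs f                                        ≡⟨ ∑-upTo-const m (∑ xs f) ⟨
      ∑[ _ ← upTo m ] ∑ xs f
        ≡⟨ ∑-cong-all (upTo m) (λ j → trans (∑-cong-all xs (λ x → cong f (sym (+-identityʳ x))))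
             (periodic-1⇒constant (invariant f-m) 0 j)) ⟩
      ∑[ j ← upTo m ] (∑[ x ← xs ] f (x + j))           ≡⟨ ∑-swap (upTo m) xs _ ⟩
      ∑[ x ← xs ] (∑[ j ← upTo m ] f (x + j))           ≡⟨ ∑-cong-all xs (λ x → ∑-interval ∣-refl f-m x 0) ⟩
      ∑[ _ ← xs ] ∑ (upTo m) f                          ≡⟨ ∑-const xs _ ⟩
      length xs * ∑ (upTo m) f                          ∎

    m*count : ∀ {r} → r < m → m * countMod m r xs ≡ length xs
    m*count {r} r<m = begin-equality
      m * countMod m r xs                            ≡⟨ cong (m *_) (countMod≡∑ r) ⟩
      m * ∑[ x ← xs ] χ (x % m) r                    ≡⟨ m*∑ (mod-periodic m (λ x → χ x r)) ⟩
      length xs * ∑[ j ← upTo m ] χ (j % m) r        ≡⟨ cong (length xs *_) (∑-mod-χ m r<m) ⟩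
      length xs * 1                                  ≡⟨ *-identityʳ _ ⟩
      length xs                                      ∎

-- Translating the gaps by an element of the semigroup

module _ (S : NumericalSemigroup) {a : ℕ} where

  open import Data.Integer using (+_; -_)

  -- Trades the integer subtraction in `Ap` for addition in ℕ.
  Ap⁺ : ∀ {s} → member S s → (∀ t → t + a ≡ s → ¬ member S t) → Ap S a s
  Ap⁺ {s} s∈S t∉S = s∈S , λ { (t , t∈S , s-a≡t) →
    t∉S t (ℤ.+-injective (trans (cong (ℤ._+ + a) (sym s-a≡t)) (cancel (+ s) (+ a)))) t∈S }
    where
    cancel : ∀ x y → x ℤ.- y ℤ.+ y ≡ x
    cancel = ℤSolver.solve-∀

  Ap⁻ : ∀ {t} → Ap S a (t + a) → ¬ member S t
  Ap⁻ {t} (_ , t∉S) t∈S = t∉S (t , t∈S , cancel (+ t) (+ a))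
    where
    cancel : ∀ x y → x ℤ.+ y ℤ.- y ≡ x
    cancel = ℤSolver.solve-∀

  *-closed : ∀ {x} k → member S x → member S (k * x)
  *-closed zero    x∈S = 0∈ S
  *-closed (suc k) x∈S = +-closed S x∈S (*-closed k x∈S)

module _ (S : NumericalSemigroup) {a : ℕ} .{{_ : NonZero a}} (a∈S : member S a)
         {apery : List ℕ} (apery! : Unique apery) (∈apery⇔ : ∀ {s} → s ∈ₗ apery ⇔ s ∈ Ap S a) where

  -- Both lists enumerate once each x for which x - a is not in S. The left side splits them by
  -- whether x ≥ a, the right side by whether x lies in S.
  gaps-apery-↭ : map (_+ a) (H S) ++ upTo a ↭ H S ++ apery
  gaps-apery-↭ = ∼bag⇒↭ (unique∧set⇒bag
    (Unique.++⁺ (Unique.map⁺ (+-cancelʳ-≡ a _ _) (unique S)) (Unique.upTo⁺ a) shifted≥a)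
    (Unique.++⁺ (unique S) apery! (λ (x∈H , x∈ap) → gap x∈H (proj₁ (to ∈apery⇔ x∈ap))))
    (mk⇔ ⊆ ⊇))
    where
    gap : ∀ {x} → x ∈ₗ H S → ¬ member S x
    gap {x} = to (gaps⇔ S x)

    shifted≥a : ∀ {x} → ¬ (x ∈ₗ map (_+ a) (H S) × x ∈ₗ upTo a)
    shifted≥a (x∈map , x∈upTo) with g , _ , refl ← ∈-map⁻ (_+ a) x∈map =
      <⇒≱ (∈-upTo⁻ x∈upTo) (m≤n+m a g)

    classify : ∀ {x} → (∀ t → t + a ≡ x → ¬ member S t) → x ∈ₗ H S ++ apery
    classify {x} x-a∉S with member? S x
    ... | yes x∈S = ∈-++⁺ʳ (H S) (from ∈apery⇔ (Ap⁺ S x∈S x-a∉S))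
    ... | no  x∉S = ∈-++⁺ˡ (from (gaps⇔ S x) x∉S)

    ⊆ : ∀ {x} → x ∈ₗ map (_+ a) (H S) ++ upTo a → x ∈ₗ H S ++ apery
    ⊆ x∈ with ∈-++⁻ (map (_+ a) (H S)) x∈
    ... | inj₁ x∈map with g , g∈H , refl ← ∈-map⁻ (_+ a) x∈map =
      classify (λ t eq t∈S → gap g∈H (subst (member S) (+-cancelʳ-≡ a t g eq) t∈S))
    ... | inj₂ x∈upTo = classify λ { t refl _ → <⇒≱ (∈-upTo⁻ x∈upTo) (m≤n+m a t) }

    split : ∀ {x} → (∀ t → t + a ≡ x → ¬ member S t) → x ∈ₗ map (_+ a) (H S) ++ upTo a
    split {x} x-a∉S with x <? a
    ... | yes x<a = ∈-++⁺ʳ _ (∈-upTo⁺ x<a)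
    ... | no  x≮a = ∈-++⁺ˡ (subst (_∈ₗ map (_+ a) (H S)) x-a+a≡x
                      (∈-map⁺ (_+ a) (from (gaps⇔ S (x ∸ a)) (x-a∉S (x ∸ a) x-a+a≡x))))
      where
      x-a+a≡x : x ∸ a + a ≡ x
      x-a+a≡x = m∸n+n≡m (≮⇒≥ x≮a)

    ⊇ : ∀ {x} → x ∈ₗ H S ++ apery → x ∈ₗ map (_+ a) (H S) ++ upTo a
    ⊇ x∈ with ∈-++⁻ (H S) x∈
    ... | inj₁ x∈H  = split λ { t refl t∈S → gap x∈H (+-closed S t∈S a∈S) }
    ... | inj₂ x∈ap = split λ { t refl → Ap⁻ S (to ∈apery⇔ x∈ap) }

  ∑-gaps-apery : ∀ f → ∑[ x ← H S ] f (x + a) + ∑ (upTo a) f ≡ ∑ (H S) f + ∑ apery f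
  ∑-gaps-apery f = begin-equality
    ∑[ x ← H S ] f (x + a) + ∑ (upTo a) f    ≡⟨ cong (_+ ∑ (upTo a) f) (∑-map (H S) (_+ a) f) ⟨
    ∑ (map (_+ a) (H S)) f + ∑ (upTo a) f    ≡⟨ ∑-++ (map (_+ a) (H S)) (upTo a) f ⟨
    ∑ (map (_+ a) (H S) ++ upTo a) f         ≡⟨ ∑-↭ f gaps-apery-↭ ⟩
    ∑ (H S ++ apery) f                       ≡⟨ ∑-++ (H S) apery f ⟩
    ∑ (H S) f + ∑ apery f                    ∎

-- Gap sums for an arithmetic Apéry set

-- Indices count from 0 and a is `suc n`, so that i < n runs through the nonzero Apéry elements ha +
-- d, ..., ha + (a - 1)d.
term : (n h d i : ℕ) → ℕ
term n h d i = h * suc n + suc i * d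

-- Expresses that the nonzero Apéry elements and 1, ..., a - 1 agree as multisets modulo m. Testing
-- against periodic functions keeps this in the language of sums.
AperyMod : (n h d m : ℕ) → Set
AperyMod n h d m = ∀ {f} → Periodic m f →
  ∑[ i ← upTo n ] f (suc i) ≡ ∑[ i ← upTo n ] f (term n h d i)

module _ (S : NumericalSemigroup) {n : ℕ} (a∈S : member S (suc n))
         {h d : ℕ} .{{_ : NonZero d}}
         (apery : ∀ {s} → s ∈ Ap∖0 S (suc n) ⇔ (∃[ i ] i < n × s ≡ term n h d i)) where

  private
    a : ℕ
    a = suc n
    t : ℕ → ℕ
    t = term n h d

  -- The element 0 belongs both to the Apéry set and to the interval 0, ..., a - 1, so `f 0` cancels
  -- in `∑-gaps-apery`.
  ∑-gaps-arithmetic : ∀ f → ∑[ x ← H S ] f (x + a) + ∑[ i ← upTo n ] f (suc i) ≡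
                            ∑ (H S) f + ∑[ i ← upTo n ] f (t i)
  ∑-gaps-arithmetic f = +-cancelˡ-≡ (f 0) _ _ (begin-equality
    f 0 + (∑[ x ← H S ] f (x + a) + ∑[ i ← upTo n ] f (suc i))
      ≡⟨ exchange (f 0) (∑[ x ← H S ] f (x + a)) _ ⟩
    ∑[ x ← H S ] f (x + a) + (f 0 + ∑[ i ← upTo n ] f (suc i))
      ≡⟨ cong (∑[ x ← H S ] f (x + a) +_) (∑-first n f) ⟨
    ∑[ x ← H S ] f (x + a) + ∑ (upTo a) f                        ≡⟨ ∑-gaps-apery S a∈S list! (mk⇔ ⊆ ⊇) f ⟩
    ∑ (H S) f + (f 0 + ∑ (map t (upTo n)) f)
      ≡⟨ cong (λ z → ∑ (H S) f + (f 0 + z)) (∑-map (upTo n) t f) ⟩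
    ∑ (H S) f + (f 0 + ∑[ i ← upTo n ] f (t i))                  ≡⟨ exchange (f 0) (∑ (H S) f) _ ⟨
    f 0 + (∑ (H S) f + ∑[ i ← upTo n ] f (t i))                  ∎)
    where
    exchange : ∀ x y z → x + (y + z) ≡ y + (x + z)
    exchange = solve-∀

    t-injective : ∀ {i j} → t i ≡ t j → i ≡ j
    t-injective {i} {j} eq = suc-injective (*-cancelʳ-≡ (suc i) (suc j) d (+-cancelˡ-≡ (h * a) _ _ eq))

    nonzero : ∀ {i} → i ∈ₗ upTo n → 0 ≢ t i
    nonzero {i} i∈ = proj₂ (from apery (i , ∈-upTo⁻ i∈ , refl))

    list! : Unique (0 ∷ map t (upTo n))
    list! = All.tabulate 0∉ ∷ Unique.map⁺ t-injective (Unique.upTo⁺ n)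
      where
      0∉ : ∀ {x} → x ∈ₗ map t (upTo n) → 0 ≢ x
      0∉ x∈ with i , i∈ , refl ← ∈-map⁻ t x∈ = nonzero i∈

    ⊆ : ∀ {s} → s ∈ₗ 0 ∷ map t (upTo n) → s ∈ Ap S a
    ⊆ (here refl) = Ap⁺ S {a} (0∈ S) (λ k k+a≡0 _ → contradiction (m+n≡0⇒n≡0 k {a} k+a≡0) λ ())
    ⊆ (there s∈)  with i , i∈ , refl ← ∈-map⁻ t s∈ = proj₁ (from apery (i , ∈-upTo⁻ i∈ , refl))

    ⊇ : ∀ {s} → s ∈ Ap S a → s ∈ₗ 0 ∷ map t (upTo n)
    ⊇ {zero}  _    = here refl
    ⊇ {suc s} s∈Ap with i , i<n , s≡ti ← to apery (s∈Ap , λ ()) =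
      there (subst (_∈ₗ map t (upTo n)) (sym s≡ti) (∈-map⁺ t (∈-upTo⁺ i<n)))

  -- The summation identity for f x = x φ(x), folded under the reflection
  -- i ↦ a - i of the residues; φ = 1 is the genus formula.
  ∑-gaps-even : gcd a d ≡ 1 → ∀ {φ} → Periodic a φ → (∀ x y → a ∣ x + y → φ x ≡ φ y) →
    2 * ∑ (H S) φ + ∑[ i ← upTo n ] φ (suc i) ≡ (2 * h + d) * ∑[ i ← upTo n ] φ (suc i)
  ∑-gaps-even a⊥d {φ} φ-a even = *-cancelˡ-≡ _ _ a (begin-equality
    a * (2 * ∑ (H S) φ + A)                                  ≡⟨ rearrange a (∑ (H S) φ) A ⟩
    2 * (a * ∑ (H S) φ) + a * A
      ≡⟨ cong (2 * (a * ∑ (H S) φ) +_) (∑-reflect-weighted n suc (φ ∘ suc) sum-suc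
           (λ i j eq → even (suc i) (suc j) (subst (a ∣_) (sym (sum-suc i j eq)) ∣-refl))) ⟨
    2 * (a * ∑ (H S) φ) + 2 * ∑[ i ← upTo n ] (suc i * φ (suc i))  ≡⟨ *-distribˡ-+ 2 (a * ∑ (H S) φ) _ ⟨
    2 * (a * ∑ (H S) φ + ∑[ i ← upTo n ] (suc i * φ (suc i)))      ≡⟨ cong (2 *_) weighted ⟩
    2 * ∑[ i ← upTo n ] (t i * φ (t i))
      ≡⟨ ∑-reflect-weighted n t (φ ∘ t) sum-t (λ i j eq → even (t i) (t j) (divides (2 * h + d) (sum-t i j eq))) ⟩
    (2 * h + d) * a * ∑[ i ← upTo n ] φ (t i)                ≡⟨ cong ((2 * h + d) * a *_) ∑φt≡A ⟩
    (2 * h + d) * a * A                                      ≡⟨ rearrange′ (2 * h + d) a A ⟩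
    a * ((2 * h + d) * A)                                    ∎)
    where
    A : ℕ
    A = ∑[ i ← upTo n ] φ (suc i)

    rearrange : ∀ a x y → a * (2 * x + y) ≡ 2 * (a * x) + a * y
    rearrange = solve-∀
    rearrange′ : ∀ x a y → x * a * y ≡ a * (x * y)
    rearrange′ = solve-∀

    sum-suc : ∀ i j → suc (i + j) ≡ n → suc i + suc j ≡ a
    sum-suc i j eq = cong suc (trans (+-suc i j) eq)

    sum-t : ∀ i j → suc (i + j) ≡ n → t i + t j ≡ (2 * h + d) * a
    sum-t i j refl = identity h d i j
      where
      identity : ∀ h d i j → (h * (2 + (i + j)) + suc i * d) + (h * (2 + (i + j)) + suc j * d) ≡
                             (2 * h + d) * (2 + (i + j))
      identity = solve-∀

    -- Since `φ` has period a, passing from x to x + a changes x φ(x) by a φ(x).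
    weighted : a * ∑ (H S) φ + ∑[ i ← upTo n ] (suc i * φ (suc i)) ≡ ∑[ i ← upTo n ] (t i * φ (t i))
    weighted = +-cancelˡ-≡ (∑[ x ← H S ] (x * φ x)) _ _ (begin-equality
      ∑[ x ← H S ] (x * φ x) + (a * ∑ (H S) φ + ∑[ i ← upTo n ] (suc i * φ (suc i)))
        ≡⟨ +-assoc (∑[ x ← H S ] (x * φ x)) _ _ ⟨
      ∑[ x ← H S ] (x * φ x) + a * ∑ (H S) φ + ∑[ i ← upTo n ] (suc i * φ (suc i))
        ≡⟨ cong (λ z → ∑[ x ← H S ] (x * φ x) + z + ∑[ i ← upTo n ] (suc i * φ (suc i))) (∑-*ˡ (H S) a φ) ⟨
      ∑[ x ← H S ] (x * φ x) + ∑[ x ← H S ] (a * φ x) + ∑[ i ← upTo n ] (suc i * φ (suc i))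
        ≡⟨ cong (_+ ∑[ i ← upTo n ] (suc i * φ (suc i))) (∑-+ (H S) (λ x → x * φ x) (λ x → a * φ x)) ⟨
      ∑[ x ← H S ] (x * φ x + a * φ x) + ∑[ i ← upTo n ] (suc i * φ (suc i))
        ≡⟨ cong (_+ ∑[ i ← upTo n ] (suc i * φ (suc i))) (∑-cong-all (H S) (λ x →
             trans (sym (*-distribʳ-+ (φ x) x a)) (cong ((x + a) *_) (sym (φ-a x))))) ⟩
      ∑[ x ← H S ] ((x + a) * φ (x + a)) + ∑[ i ← upTo n ] (suc i * φ (suc i))
        ≡⟨ ∑-gaps-arithmetic (λ x → x * φ x) ⟩
      ∑[ x ← H S ] (x * φ x) + ∑[ i ← upTo n ] (t i * φ (t i)) ∎)

    -- Adjoining the index 0 completes both sides to a full residue system modulo a.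
    ∑φt≡A : ∑[ i ← upTo n ] φ (t i) ≡ A
    ∑φt≡A = +-cancelˡ-≡ (φ 0) _ _ (begin-equality
      φ 0 + ∑[ i ← upTo n ] φ (t i)
        ≡⟨ cong (_+ ∑[ i ← upTo n ] φ (t i))
           (trans (sym (periodic-* φ-a h 0)) (cong φ (sym (+-identityʳ (h * a))))) ⟩
      φ (h * a + 0) + ∑[ i ← upTo n ] φ (t i)             ≡⟨ ∑-first n (λ i → φ (h * a + i * d)) ⟨
      ∑[ i ← upTo a ] φ (h * a + i * d)                   ≡⟨ ∑-cycle a⊥d ∣-refl φ-a (h * a) 0 ⟩
      ∑ (upTo a) φ                                        ≡⟨ ∑-first n φ ⟩
      φ 0 + A                                             ∎)

  module _ (m : ℕ) .{{_ : NonZero m}} where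

    -- Put g = gcd(a, m), m = pg and D = 2h + d - 1; let L be the number of gaps, c their number in
    -- each class, and A the number of multiples of g in 1, ..., n. Then `∑-gaps-even` gives 2L = Dn
    -- for φ = 1 and 2cp = DA for the indicator of the multiples of g, while L = cm = cpg. As D ≠ 0
    -- when there are gaps, n = Ag, and a = (1 + A)g forces g = 1.
    equidistributed⇒coprime-a : gcd a d ≡ 1 → H S ≢ [] → Equidistributed m (H S) → gcd a m ≡ 1
    equidistributed⇒coprime-a a⊥d H≢[] equi =
      conclude (gcd[m,n]∣m a m) (gcd[m,n]∣n a m) {{≢-nonZero (gcd[m,n]≢0 a m (inj₁ λ ()))}}
      where
      L c : ℕ
      L = length (H S)
      c = countMod m 0 (H S)

      excess : ∀ T x y → 2 * x + y ≡ T * y → 2 * x ≡ (T ∸ 1) * y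
      excess T x y eq = begin-equality
        2 * x            ≡⟨ m+n∸n≡m (2 * x) y ⟨
        2 * x + y ∸ y    ≡⟨ cong (_∸ y) eq ⟩
        T * y ∸ y        ≡⟨ cong (T * y ∸_) (*-identityˡ y) ⟨
        T * y ∸ 1 * y    ≡⟨ *-distribʳ-∸ y T 1 ⟨
        (T ∸ 1) * y      ∎

      D : ℕ
      D = 2 * h + d ∸ 1

      L≡c*m : L ≡ c * m
      L≡c*m = begin-equality
        L                            ≡⟨ *-identityʳ L ⟨
        L * 1                        ≡⟨ ∑-const (H S) 1 ⟨
        ∑[ _ ← H S ] 1               ≡⟨ equidistributed⇒∑ m (H S) equi (λ _ → refl) ⟩
        c * ∑[ _ ← upTo m ] 1        ≡⟨ cong (c *_) (trans (∑-upTo-const m 1) (*-identityʳ m)) ⟩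
        c * m                        ∎

      genus : 2 * L ≡ D * n
      genus = excess (2 * h + d) L n (subst₂ (λ x y → 2 * x + y ≡ (2 * h + d) * y)
        (trans (∑-const (H S) 1) (*-identityʳ L)) (trans (∑-upTo-const n 1) (*-identityʳ n))
        (∑-gaps-even a⊥d {λ _ → 1} (λ _ → refl) (λ _ _ _ → refl)))

      D≢0 : D ≢ 0
      D≢0 D≡0 = H≢[] (length≡0 (m*n≡0⇒n≡0 2 (trans genus (cong (_* n) D≡0))))
        where
        m*n≡0⇒n≡0 : ∀ k .{{_ : NonZero k}} {x} → k * x ≡ 0 → x ≡ 0
        m*n≡0⇒n≡0 k {x} eq = *-cancelˡ-≡ x 0 k (trans eq (sym (*-zeroʳ k)))
        length≡0 : ∀ {xs : List ℕ} → length xs ≡ 0 → xs ≡ []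
        length≡0 {[]} _ = refl

      conclude : ∀ {g} → g ∣ a → g ∣ m → .{{_ : NonZero g}} → g ≡ 1
      conclude {g} g∣a@(divides q a≡qg) g∣m@(divides p m≡pg) = sym (+-cancelʳ-≡ n 1 g (begin-equality
        1 + n           ≡⟨ a≡qg ⟩
        q * g           ≡⟨ cong (_* g) 1+A≡q ⟨
        (1 + A) * g     ≡⟨⟩
        g + A * g       ≡⟨ cong (g +_) n≡A*g ⟨
        g + n           ∎))
        where
        φ : ℕ → ℕ
        φ x = χ (x % g) 0

        φ-g : Periodic g φ
        φ-g = mod-periodic g (λ x → χ x 0)

        A : ℕ
        A = ∑[ i ← upTo n ] φ (suc i)

        ∑φ : ∀ k → ∑ (upTo (k * g)) φ ≡ k
        ∑φ k = trans (∑-periods φ-g k) (trans (cong (k *_) (∑-mod-χ g (>-nonZero⁻¹ g))) (*-identityʳ k))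

        1+A≡q : 1 + A ≡ q
        1+A≡q = begin-equality
          1 + A              ≡⟨ cong (_+ A) (cong (λ x → χ x 0) (m*n%n≡0 0 g)) ⟨
          φ 0 + A            ≡⟨ ∑-first n φ ⟨
          ∑ (upTo a) φ       ≡⟨ cong (λ k → ∑ (upTo k) φ) a≡qg ⟩
          ∑ (upTo (q * g)) φ ≡⟨ ∑φ q ⟩
          q                  ∎

        ∑Hφ : ∑ (H S) φ ≡ c * p
        ∑Hφ = trans (equidistributed⇒∑ m (H S) equi (periodic-∣ φ-g g∣m))
                    (cong (c *_) (trans (cong (λ k → ∑ (upTo k) φ) m≡pg) (∑φ p)))

        negate : ∀ x y → a ∣ x + y → x % g ≡ 0 → y % g ≡ 0
        negate x y a∣x+y x≡0 = n∣m⇒m%n≡0 y g (∣m+n∣m⇒∣n (∣-trans g∣a a∣x+y) (m%n≡0⇒n∣m x g x≡0))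

        even : ∀ x y → a ∣ x + y → φ x ≡ φ y
        even x y a∣x+y with x % g ≟ 0
        ... | yes x≡0 = cong (λ z → χ z 0) (trans x≡0 (sym (negate x y a∣x+y x≡0)))
        ... | no  x≢0 = trans (χ-≢ x≢0) (sym (χ-≢ (x≢0 ∘ negate y x (subst (a ∣_) (+-comm x y) a∣x+y))))

        n≡A*g : n ≡ A * g
        n≡A*g = *-cancelˡ-≡ n (A * g) D {{≢-nonZero D≢0}} (begin-equality
          D * n              ≡⟨ genus ⟨
          2 * L              ≡⟨ cong (2 *_) (trans L≡c*m (cong (c *_) m≡pg)) ⟩
          2 * (c * (p * g))  ≡⟨ assoc c p g ⟩
          2 * (c * p) * g
            ≡⟨ cong (_* g) (excess (2 * h + d) (c * p) A
               (subst (λ x → 2 * x + A ≡ (2 * h + d) * A) ∑Hφ (∑-gaps-even a⊥d (periodic-∣ φ-g g∣a) even))) ⟩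
          D * A * g          ≡⟨ *-assoc D A g ⟩
          D * (A * g)        ∎)
          where
          assoc : ∀ c p g → 2 * (c * (p * g)) ≡ 2 * (c * p) * g
          assoc = solve-∀

    equidistributed⇒AperyMod : Equidistributed m (H S) → AperyMod n h d m
    equidistributed⇒AperyMod equi {f} f-m = +-cancelˡ-≡ (∑ (H S) f) _ _
      (subst (λ z → z + ∑[ i ← upTo n ] f (suc i) ≡ ∑ (H S) f + ∑[ i ← upTo n ] f (t i)) shift
        (∑-gaps-arithmetic f))
      where
      shift : ∑[ x ← H S ] f (x + a) ≡ ∑ (H S) f
      shift = begin-equality
        ∑[ x ← H S ] f (x + a)
          ≡⟨ equidistributed⇒∑ m (H S) equi (periodic-∘+ f-m a) ⟩
        countMod m 0 (H S) * ∑[ x ← upTo m ] f (x + a)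
          ≡⟨ cong (countMod m 0 (H S) *_) (∑-cong-all (upTo m) (λ x → cong f (+-comm x a))) ⟩
        countMod m 0 (H S) * ∑[ x ← upTo m ] f (a + x)
          ≡⟨ cong (countMod m 0 (H S) *_) (∑-interval ∣-refl f-m a 0) ⟩
        countMod m 0 (H S) * ∑ (upTo m) f                    ≡⟨ equidistributed⇒∑ m (H S) equi f-m ⟨
        ∑ (H S) f                                            ∎

    AperyMod⇒equidistributed : gcd a m ≡ 1 → AperyMod n h d m → Equidistributed m (H S)
    AperyMod⇒equidistributed a⊥m apery-m = shift-invariant⇒equidistributed m (H S) invariant
      where
      invariant : ∀ {f} → Periodic m f → Periodic 1 (λ y → ∑[ x ← H S ] f (x + y))
      invariant {f} f-m y = periodic-coprime a⊥m a-periodic m-periodic (y + 1) y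
        where
        m-periodic : Periodic m (λ y → ∑[ x ← H S ] f (x + y))
        m-periodic y = ∑-cong-all (H S) (λ x → trans (cong f (sym (+-assoc x y m))) (f-m (x + y)))

        -- The identity is applied to the translate of `f` by y; the interval and Apéry terms cancel
        -- by hypothesis.
        a-periodic : Periodic a (λ y → ∑[ x ← H S ] f (x + y))
        a-periodic y = +-cancelʳ-≡ (∑[ i ← upTo n ] f (suc i + y)) _ _ (begin-equality
          ∑[ x ← H S ] f (x + (y + a)) + ∑[ i ← upTo n ] f (suc i + y)
            ≡⟨ cong (_+ ∑[ i ← upTo n ] f (suc i + y)) (∑-cong-all (H S) (λ x →
               cong f (trans (cong (x +_) (+-comm y a)) (sym (+-assoc x a y))))) ⟩
          ∑[ x ← H S ] f (x + a + y) + ∑[ i ← upTo n ] f (suc i + y)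
            ≡⟨ ∑-gaps-arithmetic (λ x → f (x + y)) ⟩
          ∑[ x ← H S ] f (x + y) + ∑[ i ← upTo n ] f (t i + y)
            ≡⟨ cong (∑[ x ← H S ] f (x + y) +_) (apery-m (periodic-∘+ f-m y)) ⟨
          ∑[ x ← H S ] f (x + y) + ∑[ i ← upTo n ] f (suc i + y) ∎)

-- Progressions and intervals modulo m

suc%≡%⇒≡1 : ∀ x g .{{_ : NonZero g}} → suc x % g ≡ x % g → g ≡ 1
suc%≡%⇒≡1 x g eq = ∣1⇒≡1 (∣m+n∣m⇒∣n
  (subst (g ∣_) (trans q′g≡1+qg (+-comm 1 _)) (n∣m*n (suc x / g))) (n∣m*n (x / g)))
  where
  q′g≡1+qg : suc x / g * g ≡ suc (x / g * g)
  q′g≡1+qg = +-cancelˡ-≡ (x % g) _ _ (begin-equality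
    x % g + suc x / g * g       ≡⟨ cong (_+ suc x / g * g) eq ⟨
    suc x % g + suc x / g * g   ≡⟨ m≡m%n+[m/n]*n (suc x) g ⟨
    suc x                       ≡⟨ cong suc (m≡m%n+[m/n]*n x g) ⟩
    suc (x % g + x / g * g)     ≡⟨ +-suc (x % g) _ ⟨
    x % g + suc (x / g * g)     ∎)

-- Modulo g = gcd(d, m) the progression is constant, so 1, ..., n all lie in one class. If n ≥ 2,
-- the consecutive numbers 1 and 2 give g = 1; if n = 1, then h = 0 puts 1 in the class of 0.
AperyMod⇒coprime-d : ∀ {n h d m} .{{_ : NonZero m}} → 1 ≤ n → (n ≡ 1 → h ≡ 0) →
                     AperyMod n h d m → gcd d m ≡ 1
AperyMod⇒coprime-d {n} {h} {d} {m} 1≤n n≡1⇒h≡0 apery-m =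
  coprime 1≤n n≡1⇒h≡0 {{≢-nonZero (gcd[m,n]≢0 d m (inj₂ (≢-nonZero⁻¹ m)))}}
  where
  g : ℕ
  g = gcd d m

  -- Modulo g every term of the progression is h a.
  residue : .{{_ : NonZero g}} → ∀ {j} → j < n → h * suc n % g ≡ suc j % g
  residue {j} j<n = 1≤χ⇒≡ _ _ (n≢0⇒n>0 λ f≡0 → 1+n≰n (1≤0 f≡0))
    where
    f : ℕ → ℕ
    f x = χ (x % g) (suc j % g)

    f-g : Periodic g f
    f-g = mod-periodic g (λ x → χ x (suc j % g))

    1≤0 : f (h * suc n) ≡ 0 → 1 ≤ 0
    1≤0 f≡0 = begin
      1                                        ≡⟨ χ-refl (suc j % g) ⟨
      f (suc j)                                ≤⟨ ∑-term n (f ∘ suc) j<n ⟩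
      ∑[ i ← upTo n ] f (suc i)                ≡⟨ apery-m (periodic-∣ f-g (gcd[m,n]∣n d m)) ⟩
      ∑[ i ← upTo n ] f (term n h d i)
        ≡⟨ ∑-zero n (λ {i} _ → trans (periodic-* (periodic-∣ f-g (gcd[m,n]∣m d m)) (suc i) (h * suc n)) f≡0) ⟩
      0                                        ∎

  coprime : 1 ≤ n → (n ≡ 1 → h ≡ 0) → .{{_ : NonZero g}} → g ≡ 1
  coprime 1≤n n≡1⇒h≡0 with m≤n⇒m<n∨m≡n 1≤n
  ... | inj₁ 2≤n = suc%≡%⇒≡1 1 g (trans (sym (residue 2≤n)) (residue 1≤n))
  ... | inj₂ 1≡n = suc%≡%⇒≡1 0 g (trans (sym (residue 1≤n)) (cong (λ x → x * suc n % g) (n≡1⇒h≡0 (sym 1≡n))))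

module _ {n h d m′ : ℕ} (apery-m : AperyMod n h d (suc m′)) where

  private
    m r e u v : ℕ
    m = suc m′
    r = n % m
    e = d % m
    u = term n h d 0 + m′
    v = term n h d n + m′

  -- Comparing the progression with its translate by d leaves only its end
  -- points; the first r of n = r + q m residues carry all the information.
  -- Intervals start at 0 rather than 1, whence the shift of u and v by -1.
  boundary : ∀ {f} → Periodic m f →
             f u + ∑[ i ← upTo r ] f (i + e) ≡ ∑ (upTo r) f + f v
  boundary {f} f-m = begin-equality
    f u + ∑[ i ← upTo r ] f (i + e)       ≡⟨ cong (f u +_) (∑-cong-all (upTo r) i+e) ⟩
    f u + ∑[ i ← upTo r ] f (i + d)       ≡⟨ +-cancelʳ-≡ Q _ _ whole ⟩
    ∑ (upTo r) f + f v                    ∎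
    where
    -- The last `q` indices fill whole periods, so their sum `Q` is the same from any starting point
    -- and can be cancelled.
    q Q : ℕ
    q = n / m * m
    Q = ∑[ i ← upTo q ] f (r + i)

    m∣q : m ∣ q
    m∣q = n∣m*n (n / m)

    i+e : ∀ i → f (i + e) ≡ f (i + d)
    i+e i = begin-equality
      f (i + e)                     ≡⟨ periodic-* f-m (d / m) (i + e) ⟨
      f (i + e + d / m * m)         ≡⟨ cong f (+-assoc i e _) ⟩
      f (i + (e + d / m * m))       ≡⟨ cong (λ x → f (i + x)) (m≡m%n+[m/n]*n d m) ⟨
      f (i + d)                     ∎

    suc-shift : ∀ i → f (suc i + m′) ≡ f i
    suc-shift i = trans (cong f (sym (+-suc i m′))) (f-m i)

    interval : ∑ (upTo n) f ≡ ∑ (upTo r) f + Q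
    interval = trans (cong (λ k → ∑ (upTo k) f) (m≡m%n+[m/n]*n n m)) (∑-upTo-+ r q f)

    shifted-interval : ∑[ i ← upTo n ] f (i + d) ≡ ∑[ i ← upTo r ] f (i + d) + Q
    shifted-interval = begin-equality
      ∑[ i ← upTo n ] f (i + d)
        ≡⟨ cong (λ k → ∑[ i ← upTo k ] f (i + d)) (m≡m%n+[m/n]*n n m) ⟩
      ∑[ i ← upTo (r + q) ] f (i + d)
        ≡⟨ ∑-upTo-+ r q (λ i → f (i + d)) ⟩
      ∑[ i ← upTo r ] f (i + d) + ∑[ i ← upTo q ] f (r + i + d)
        ≡⟨ cong (∑[ i ← upTo r ] f (i + d) +_) (∑-cong-all (upTo q) (λ i → cong f (rotate r i d))) ⟩
      ∑[ i ← upTo r ] f (i + d) + ∑[ i ← upTo q ] f (r + d + i)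
        ≡⟨ cong (∑[ i ← upTo r ] f (i + d) +_) (∑-interval m∣q f-m (r + d) r) ⟩
      ∑[ i ← upTo r ] f (i + d) + Q ∎
      where
      rotate : ∀ x y z → x + y + z ≡ x + z + y
      rotate = solve-∀

    apery-sum : ∑ (upTo n) f ≡ ∑[ i ← upTo n ] f (term n h d i + m′)
    apery-sum = trans (∑-cong-all (upTo n) (λ i → sym (suc-shift i))) (apery-m (periodic-∘+ f-m m′))

    -- The test function is translated by d - 1, with `m′` standing for -1 modulo m, so that each
    -- term turns into its successor.
    shifted-apery-sum : ∑[ i ← upTo n ] f (i + d) ≡ ∑[ i ← upTo n ] f (term n h d (suc i) + m′)
    shifted-apery-sum = begin-equality
      ∑[ i ← upTo n ] f (i + d)
        ≡⟨ ∑-cong-all (upTo n) (λ i → trans (sym (f-m (i + d))) (cong f (shift₁ i d m′))) ⟩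
      ∑[ i ← upTo n ] f (suc i + (d + m′))           ≡⟨ apery-m (periodic-∘+ f-m (d + m′)) ⟩
      ∑[ i ← upTo n ] f (term n h d i + (d + m′))
        ≡⟨ ∑-cong-all (upTo n) (λ i → cong f (shift₂ (h * suc n) i d m′)) ⟩
      ∑[ i ← upTo n ] f (term n h d (suc i) + m′)    ∎
      where
      shift₁ : ∀ i d m′ → i + d + suc m′ ≡ suc i + (d + m′)
      shift₁ = solve-∀
      shift₂ : ∀ x i d m′ → x + suc i * d + (d + m′) ≡ x + suc (suc i) * d + m′
      shift₂ = solve-∀

    whole : f u + ∑[ i ← upTo r ] f (i + d) + Q ≡ ∑ (upTo r) f + f v + Q
    whole = begin-equality
      f u + ∑[ i ← upTo r ] f (i + d) + Q                          ≡⟨ +-assoc (f u) _ Q ⟩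
      f u + (∑[ i ← upTo r ] f (i + d) + Q)
        ≡⟨ cong (f u +_) (trans (sym shifted-interval) shifted-apery-sum) ⟩
      f u + ∑[ i ← upTo n ] f (term n h d (suc i) + m′)
        ≡⟨ ∑-telescope n (λ i → f (term n h d i + m′)) ⟩
      ∑[ i ← upTo n ] f (term n h d i + m′) + f v
        ≡⟨ cong (_+ f v) (trans (sym apery-sum) interval) ⟩
      ∑ (upTo r) f + Q + f v                                       ≡⟨ rotate (∑ (upTo r) f) Q (f v) ⟩
      ∑ (upTo r) f + f v + Q                                       ∎
      where
      rotate : ∀ x y z → x + y + z ≡ x + z + y
      rotate = solve-∀

  -- In `boundary` for the indicator of t, the interval contributes to the right side and the
  -- translate nothing to the left; only `u` can make up for it.
  u-residue : ∀ {t} → t < r → (∀ {i} → i < r → (i + e) % m ≢ t) → u % m ≡ t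
  u-residue {t} t<r t∉ = 1≤χ⇒≡ _ _ 1≤fu
    where
    f : ℕ → ℕ
    f x = χ (x % m) t

    1≤fu : 1 ≤ f u
    1≤fu = begin
      1
        ≡⟨ trans (cong (λ x → χ x t) (m<n⇒m%n≡m (<-trans t<r (m%n<n n m)))) (χ-refl t) ⟨
      f t                                  ≤⟨ ∑-term r f t<r ⟩
      ∑ (upTo r) f                         ≤⟨ m≤m+n _ (f v) ⟩
      ∑ (upTo r) f + f v                   ≡⟨ boundary (mod-periodic m (λ x → χ x t)) ⟨
      f u + ∑[ i ← upTo r ] f (i + e)      ≡⟨ cong (f u +_) (∑-zero r (λ i<r → χ-≢ (t∉ i<r))) ⟩
      f u + 0                              ≡⟨ +-identityʳ (f u) ⟩
      f u                                  ∎

  -- The translate of {0, …, r - 1} by e leaves it only at v.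
  no-adjacent-exits : ∀ {i} → suc i < r → r ≤ i + e → ¬ suc i + e < m
  no-adjacent-exits {i} 1+i<r r≤i+e 1+i+e<m = 1+n≰n 2≤1
    where
    -- By truncated subtraction, `g` is the indicator of r ≤ x.
    g f : ℕ → ℕ
    g x = 1 ∸ (r ∸ x)
    f x = g (x % m)

    outside : ∀ {x} → r ≤ x → x < m → 1 ≤ f x
    outside {x} r≤x x<m = ≤-reflexive (sym (trans (cong g (m<n⇒m%n≡m x<m)) (cong (1 ∸_) (m≤n⇒m∸n≡0 r≤x))))

    inside : ∀ {x} → x < r → f x ≡ 0
    inside {x} x<r = trans (cong g (m<n⇒m%n≡m (<-trans x<r (m%n<n n m)))) (m≤n⇒m∸n≡0 (m<n⇒0<n∸m x<r))

    2≤1 : 2 ≤ 1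
    2≤1 = begin
      2
        ≤⟨ +-mono-≤ (outside r≤i+e (<-trans (n<1+n _) 1+i+e<m)) (outside (m≤n⇒m≤1+n r≤i+e) 1+i+e<m) ⟩
      f (i + e) + f (suc i + e)            ≤⟨ ∑-two-terms r (λ i → f (i + e)) 1+i<r ⟩
      ∑[ i ← upTo r ] f (i + e)            ≤⟨ m≤n+m _ (f u) ⟩
      f u + ∑[ i ← upTo r ] f (i + e)      ≡⟨ boundary (mod-periodic m g) ⟩
      ∑ (upTo r) f + f v                   ≡⟨ cong (_+ f v) (∑-zero r inside) ⟩
      f v                                  ≤⟨ m∸n≤m 1 (r ∸ v % m) ⟩
      1                                    ∎

  -- The translate e, ..., r + e - 1 does not wrap around modulo m and so misses 0.
  starts-at-0 : 1 ≤ r → 1 ≤ e → r + e ≤ m → u % m ≡ 0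
  starts-at-0 1≤r 1≤e r+e≤m = u-residue 1≤r λ {i} i<r [i+e]%m≡0 →
    <⇒≢ 1≤e (sym (m+n≡0⇒n≡0 i (trans (sym (m<n⇒m%n≡m (<-≤-trans (+-monoˡ-< e i<r) r+e≤m))) [i+e]%m≡0)))

  -- The step is -1 modulo m: the translate consists of m - 1 and 0, ..., r - 2, and so misses r -
  -- 1.
  starts-at-r-1 : 1 ≤ r → e ≡ m′ → suc (u % m) ≡ r
  starts-at-r-1 1≤r e≡m′ with r₀ , 1+r₀≡r ← m≤n⇒∃[o]m+o≡n 1≤r =
    trans (cong suc (u-residue (≤-reflexive 1+r₀≡r) r₀∉)) 1+r₀≡r
    where
    r₀∉ : ∀ {i} → i < r → (i + e) % m ≢ r₀
    r₀∉ {zero}  _   e%m≡r₀ = <⇒≢ (m%n<n n m) (begin-equality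
      r             ≡⟨ 1+r₀≡r ⟨
      suc r₀        ≡⟨ cong suc (trans (sym e%m≡r₀) (trans (m%n%n≡m%n d m) e≡m′)) ⟩
      m             ∎)
    r₀∉ {suc i} i<r [i+e]%m≡r₀ = <⇒≢ i<r (begin-equality
      suc i                     ≡⟨ cong suc (m<n⇒m%n≡m (<-trans (<-trans (n<1+n i) i<r) (m%n<n n m))) ⟨
      suc (i % m)               ≡⟨ cong suc ([m+n]%n≡m%n i m) ⟨
      suc ((i + m) % m)         ≡⟨ cong (λ x → suc (x % m)) (+-suc i m′) ⟩
      suc ((suc i + m′) % m)    ≡⟨ cong (λ x → suc ((suc i + x) % m)) e≡m′ ⟨
      suc ((suc i + e) % m)     ≡⟨ cong suc [i+e]%m≡r₀ ⟩
      suc r₀                    ≡⟨ 1+r₀≡r ⟩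
      r                         ∎)

  ∣-coprime⇒r≡0 : ∀ {x} → m ∣ x → gcd x m ≡ 1 → r ≡ 0
  ∣-coprime⇒r≡0 {x} m∣x x⊥m = n<1⇒n≡0 (subst (r <_) m≡1 (m%n<n n m))
    where
    m≡1 : m ≡ 1
    m≡1 = ∣1⇒≡1 (subst (m ∣_) x⊥m (gcd-greatest m∣x ∣-refl))

  r≡m′⇒m∣a : r ≡ m′ → m ∣ suc n
  r≡m′⇒m∣a r≡m′ = divides (suc (n / m)) (cong suc (begin-equality
    n                    ≡⟨ m≡m%n+[m/n]*n n m ⟩
    r + n / m * m        ≡⟨ cong (_+ n / m * m) r≡m′ ⟩
    m′ + n / m * m       ∎))

  -- Two adjacent points of the translate are found in r, ..., m - 1, against `no-adjacent-exits`.
  -- If r + e ≤ m they are its last two, r + e - 2 and r + e - 1. Otherwise they are m - 2 and m -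
  -- 1, where r ≤ m - 2 because r = m - 1 would make m divide a.
  intermediate-step-impossible : gcd (suc n) m ≡ 1 → 2 ≤ r → 2 ≤ e → ¬ e < m′
  intermediate-step-impossible a⊥m 2≤r 2≤e e<m′ with r + e ≤? m
  ... | yes r+e≤m with i , 2+i≡r ← m≤n⇒∃[o]m+o≡n 2≤r =
    no-adjacent-exits (≤-reflexive 2+i≡r)
      (subst₂ _≤_ (trans (+-comm i 2) 2+i≡r) refl (+-monoʳ-≤ i 2≤e))
      (subst (λ x → x + e ≤ m) (sym 2+i≡r) r+e≤m)
  ... | no r+e≰m with i , 1+e+i≡m′ ← m≤n⇒∃[o]m+o≡n e<m′ =
    no-adjacent-exits {i} (+-cancelʳ-< e _ _ (begin-strict
        suc i + e      ≡⟨ 1+i+e≡m′ i 1+e+i≡m′ ⟩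
        m′             <⟨ n<1+n m′ ⟩
        m              <⟨ ≰⇒> r+e≰m ⟩
        r + e          ∎))
      (≤-pred (begin
        suc r          ≤⟨ ≤∧≢⇒< (≤-pred (m%n<n n m)) r≢m′ ⟩
        m′             ≡⟨ 1+i+e≡m′ i 1+e+i≡m′ ⟨
        suc i + e      ∎))
      (s≤s (≤-reflexive (1+i+e≡m′ i 1+e+i≡m′)))
    where
    1+i+e≡m′ : ∀ i → suc e + i ≡ m′ → suc i + e ≡ m′
    1+i+e≡m′ i eq = trans (cong suc (+-comm i e)) eq

    r≢m′ : r ≢ m′
    r≢m′ r≡m′ = contradiction (∣-coprime⇒r≡0 (r≡m′⇒m∣a r≡m′) a⊥m) (m<n⇒n≢0 2≤r)

  -- The alternatives correspond in order to (1) to (4), `r` being the residue of a - 1 and `u`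
  -- being congruent to ha + d - 1. A residue e = 0 means m = 1, and then r = 0.
  residue-cases : gcd (suc n) m ≡ 1 → gcd d m ≡ 1 →
    r ≡ 0
    ⊎ (r ≡ 1 × u % m ≡ 0)
    ⊎ (e ≡ 1 × u % m ≡ 0)
    ⊎ (e ≡ m′ × suc (u % m) ≡ r)
  residue-cases a⊥m d⊥m with r ≟ 0 | e ≟ 0 | r ≟ 1 | e ≟ 1 | e ≟ m′
  ... | yes r≡0 | _ | _ | _ | _ = inj₁ r≡0
  ... | no r≢0 | yes e≡0 | _ | _ | _ = contradiction (∣-coprime⇒r≡0 (m%n≡0⇒n∣m d m e≡0) d⊥m) r≢0
  ... | no r≢0 | no e≢0 | yes r≡1 | _ | _ = inj₂ (inj₁ (r≡1 ,
    starts-at-0 (n≢0⇒n>0 r≢0) (n≢0⇒n>0 e≢0) (subst (λ x → x + e ≤ m) (sym r≡1) (m%n<n d m))))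
  ... | no r≢0 | no e≢0 | no _ | yes e≡1 | _ = inj₂ (inj₂ (inj₁ (e≡1 ,
    starts-at-0 (n≢0⇒n>0 r≢0) (n≢0⇒n>0 e≢0) (subst (λ x → r + x ≤ m) (sym e≡1)
      (subst (_≤ m) (+-comm 1 r) (m%n<n n m))))))
  ... | no r≢0 | no e≢0 | no _ | no _ | yes e≡m′ = inj₂ (inj₂ (inj₂ (e≡m′ ,
    starts-at-r-1 (n≢0⇒n>0 r≢0) e≡m′)))
  ... | no r≢0 | no e≢0 | no r≢1 | no e≢1 | no e≢m′ = contradiction
    (≤∧≢⇒< (≤-pred (m%n<n d m)) e≢m′)
    (intermediate-step-impossible a⊥m (2≤ r≢0 r≢1) (2≤ e≢0 e≢1))
    where
    2≤ : ∀ {x} → x ≢ 0 → x ≢ 1 → 2 ≤ x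
    2≤ x≢0 x≢1 = ≤∧≢⇒< (n≢0⇒n>0 x≢0) (x≢1 ∘ sym)

-- Conversion to and from integer congruences

open import Data.Integer using (+_; -_)

Congruences : (n h d m : ℕ) → Set
Congruences n h d m =
  + suc n ≡ + 1 [mod m ]
  ⊎ (+ suc n ≡ + 2 [mod m ] × + (2 * h + d) ≡ + 1 [mod m ])
  ⊎ (+ d ≡ + 1 [mod m ] × + h ≡ + 0 [mod m ])
  ⊎ (+ d ≡ - (+ 1) [mod m ] × + h ≡ + 1 [mod m ])

gcd-*ˡ : ∀ {a d m} → gcd a m ≡ 1 → gcd d m ≡ 1 → gcd (a * d) m ≡ 1
gcd-*ˡ {a} {d} {m} a⊥m d⊥m =
  ∣1⇒≡1 (subst (g ∣_) d⊥m (gcd-greatest (Coprime.coprime-divisor g⊥a (gcd[m,n]∣m (a * d) m)) g∣m))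
  where
  g : ℕ
  g = gcd (a * d) m
  g∣m : g ∣ m
  g∣m = gcd[m,n]∣n (a * d) m
  g⊥a : Coprime g a
  g⊥a (k∣g , k∣a) = ∣1⇒≡1 (subst (_ ∣_) a⊥m (gcd-greatest k∣a (∣-trans k∣g g∣m)))

gcd-∣ˡ : ∀ {x y m} → x ∣ y → gcd y m ≡ 1 → gcd x m ≡ 1
gcd-∣ˡ {x} {y} {m} x∣y y⊥m =
  ∣1⇒≡1 (subst (gcd x m ∣_) y⊥m (gcd-greatest (∣-trans (gcd[m,n]∣m x m) x∣y) (gcd[m,n]∣n x m)))

term-ℤ : ∀ n h d i → + term n h d i ≡ + h ℤ.* + suc n ℤ.+ + suc i ℤ.* + d
term-ℤ n h d i = cong₂ ℤ._+_ (ℤ.pos-* h (suc n)) (ℤ.pos-* (suc i) d)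

%⇒∣ : ∀ {m} .{{_ : NonZero m}} x {t} → x % m ≡ t → + m Signed.∣ + x ℤ.- + t
%⇒∣ {m} x {t} eq = Signed.divides (+ (x / m)) x-t≡qm
  where
  cancel : ∀ T Q → T ℤ.+ Q ℤ.- T ≡ Q
  cancel = ℤSolver.solve-∀
  x-t≡qm : + x ℤ.- + t ≡ + (x / m) ℤ.* + m
  x-t≡qm = trans (cong (λ y → + y ℤ.- + t) (trans (m≡m%n+[m/n]*n x m) (cong (_+ x / m * m) eq)))
    (trans (cancel (+ t) (+ (x / m * m))) (ℤ.pos-* (x / m) m))

∣-resp : ∀ {M x y} → x ≡ y → M Signed.∣ x → M ℤ.∣ y
∣-resp refl M∣x = Signed.∣⇒∣ᵤ M∣x

module _ {n h d m′ : ℕ} where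

  private
    m : ℕ
    m = suc m′
    M N K D M′ : ℤ
    M = + m
    N = + n
    K = + h
    D = + d
    M′ = + m′

  M∣M : M Signed.∣ M
  M∣M = Signed.∣-refl

  cancel-a : gcd (suc n) m ≡ 1 → ∀ {x} → M Signed.∣ + suc n ℤ.* x → M ℤ.∣ x
  cancel-a a⊥m {x} M∣ax = ℤ.coprime-divisor M (+ suc n) x
    (Coprime.sym (gcd≡1⇒coprime {suc n} {m} a⊥m)) (Signed.∣⇒∣ᵤ M∣ax)

  AperyMod⇒congruences : gcd (suc n) m ≡ 1 → gcd d m ≡ 1 → AperyMod n h d m → Congruences n h d m
  AperyMod⇒congruences a⊥m d⊥m apery-m = convert (residue-cases {n} {h} {d} apery-m a⊥m d⊥m)
    where
    u : ℕ
    u = term n h d 0 + m′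

    U≡ : + u ≡ K ℤ.* (+ 1 ℤ.+ N) ℤ.+ D ℤ.+ M′
    U≡ = cong (ℤ._+ M′) (trans (term-ℤ n h d 0) (cong (ℤ._+_ (K ℤ.* + suc n)) (ℤ.*-identityˡ D)))

    M∣u-_ : ∀ {t} → u % m ≡ t → M Signed.∣ K ℤ.* (+ 1 ℤ.+ N) ℤ.+ D ℤ.+ M′ ℤ.- + t
    M∣u-_ {t} eq = subst (λ U → M Signed.∣ U ℤ.- + t) U≡ (%⇒∣ u eq)

    convert : n % m ≡ 0
              ⊎ (n % m ≡ 1 × u % m ≡ 0)
              ⊎ (d % m ≡ 1 × u % m ≡ 0)
              ⊎ (d % m ≡ m′ × suc (u % m) ≡ n % m) →
              Congruences n h d m
    convert (inj₁ n≡0) = inj₁ (∣-resp (identity N) (%⇒∣ n n≡0))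
      where
      identity : ∀ N → N ℤ.- + 0 ≡ + 1 ℤ.+ N ℤ.- + 1
      identity = ℤSolver.solve-∀
    -- With a ≡ 2, the congruence ha + d ≡ 1 becomes 2h + d ≡ 1.
    convert (inj₂ (inj₁ (n≡1 , u≡0))) = inj₂ (inj₁ (∣-resp (identity N) (%⇒∣ n n≡1) ,
      ∣-resp (trans (identity′ K N D M′) (cong (λ x → x ℤ.+ D ℤ.- + 1) (sym (ℤ.pos-* 2 h))))
        (Signed.∣m∣n⇒∣m-n (Signed.∣m∣n⇒∣m-n (M∣u- u≡0) (Signed.∣n⇒∣m*n K (%⇒∣ n n≡1))) M∣M)))
      where
      identity : ∀ N → N ℤ.- + 1 ≡ + 1 ℤ.+ N ℤ.- + 2
      identity = ℤSolver.solve-∀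
      identity′ : ∀ K N D M′ → K ℤ.* (+ 1 ℤ.+ N) ℤ.+ D ℤ.+ M′ ℤ.- + 0 ℤ.- K ℤ.* (N ℤ.- + 1) ℤ.- (+ 1 ℤ.+ M′) ≡
                  + 2 ℤ.* K ℤ.+ D ℤ.- + 1
      identity′ = ℤSolver.solve-∀
    -- With d ≡ 1, the congruence ha + d ≡ 1 becomes ha ≡ 0, and a can be cancelled.
    convert (inj₂ (inj₂ (inj₁ (d≡1 , u≡0)))) = inj₂ (inj₂ (inj₁ (Signed.∣⇒∣ᵤ (%⇒∣ d d≡1) ,
      cancel-a a⊥m (subst (M Signed.∣_) (identity K N D M′)
        (Signed.∣m∣n⇒∣m-n (Signed.∣m∣n⇒∣m-n (M∣u- u≡0) (%⇒∣ d d≡1)) M∣M)))))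
      where
      identity : ∀ K N D M′ → K ℤ.* (+ 1 ℤ.+ N) ℤ.+ D ℤ.+ M′ ℤ.- + 0 ℤ.- (D ℤ.- + 1) ℤ.- (+ 1 ℤ.+ M′) ≡
                 (+ 1 ℤ.+ N) ℤ.* (K ℤ.- + 0)
      identity = ℤSolver.solve-∀
    -- Here ha + d - 1 ≡ n - 1 and d ≡ -1, so ha ≡ a, and a can be cancelled.
    convert (inj₂ (inj₂ (inj₂ (d≡m′ , 1+u≡n)))) = inj₂ (inj₂ (inj₂ (
      ∣-resp (identity D M′) (Signed.∣m∣n⇒∣m+n (%⇒∣ d d≡m′) M∣M) ,
      cancel-a a⊥m (subst (M Signed.∣_) (identity′ K N D M′ (+ (u % m)))
        (Signed.∣m∣n⇒∣m-n
          (Signed.∣m∣n⇒∣m-n (Signed.∣m∣n⇒∣m-n (M∣u- refl) (%⇒∣ d d≡m′)) (%⇒∣ n (sym 1+u≡n)))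
          (Signed.∣n⇒∣m*n (+ 2) M∣M))))))
      where
      identity : ∀ D M′ → D ℤ.- M′ ℤ.+ (+ 1 ℤ.+ M′) ≡ D ℤ.- (- (+ 1))
      identity = ℤSolver.solve-∀
      identity′ : ∀ K N D M′ T → K ℤ.* (+ 1 ℤ.+ N) ℤ.+ D ℤ.+ M′ ℤ.- T ℤ.- (D ℤ.- M′) ℤ.- (N ℤ.- (+ 1 ℤ.+ T)) ℤ.-
                    + 2 ℤ.* (+ 1 ℤ.+ M′) ≡ (+ 1 ℤ.+ N) ℤ.* (K ℤ.- + 1)
      identity′ = ℤSolver.solve-∀

periodic-mod : ∀ {m f} → Periodic m f → ∀ x y → + m Signed.∣ + x ℤ.- + y → f x ≡ f y
periodic-mod {m} {f} f-m x y m∣x-y with ≤-total y x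
... | inj₁ y≤x with k , refl ← m≤n⇒∃[o]m+o≡n y≤x =
  periodic-∣ f-m (∣-resp (cancel (+ y) (+ k)) m∣x-y) y
  where
  cancel : ∀ Y K → Y ℤ.+ K ℤ.- Y ≡ K
  cancel = ℤSolver.solve-∀
... | inj₂ x≤y with k , refl ← m≤n⇒∃[o]m+o≡n x≤y =
  sym (periodic-∣ f-m (∣-resp (cancel (+ x) (+ k)) (Signed.∣m⇒∣-m m∣x-y)) x)
  where
  cancel : ∀ X K → - (X ℤ.- (X ℤ.+ K)) ≡ K
  cancel = ℤSolver.solve-∀

congruences⇒AperyMod : ∀ {n h d m} → 1 ≤ n → gcd d m ≡ 1 → Congruences n h d m → AperyMod n h d m
congruences⇒AperyMod {n} {h} {d} {m} 1≤n d⊥m = cases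
  where
  M N K D : ℤ
  M = + m
  N = + n
  K = + h
  D = + d

  signed : ∀ x → M ℤ.∣ x → M Signed.∣ x
  signed x = Signed.∣ᵤ⇒∣ {M} {x}

  m⊥d : gcd m d ≡ 1
  m⊥d = trans (gcd-comm m d) d⊥m

  term-mod : ∀ {f} → Periodic m f → ∀ i y →
    M Signed.∣ K ℤ.* (+ 1 ℤ.+ N) ℤ.+ (+ 1 ℤ.+ + i) ℤ.* D ℤ.- + y → f (term n h d i) ≡ f y
  term-mod f-m i y m∣ = periodic-mod f-m (term n h d i) y
    (subst (λ t → M Signed.∣ t ℤ.- + y) (sym (term-ℤ n h d i)) m∣)

  cases : Congruences n h d m → AperyMod n h d m
  -- As `+ suc n - + 1` reduces to `+ n`, the hypothesis serves as m ∣ n, and both sums run over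
  -- whole periods.
  cases (inj₁ a≡1) {f} f-m = begin-equality
    ∑[ i ← upTo n ] f (1 + i)                       ≡⟨ ∑-cycle m⊥d a≡1 f-m (h * suc n + d) 1 ⟨
    ∑[ i ← upTo n ] f (h * suc n + d + i * d)
      ≡⟨ ∑-cong-all (upTo n) (λ i → cong f (+-assoc (h * suc n) d (i * d))) ⟩
    ∑[ i ← upTo n ] f (term n h d i)                ∎
  -- The first terms agree modulo m; the remaining a - 2 terms run over whole periods.
  cases (inj₂ (inj₁ (a≡2 , 2h+d≡1))) {f} f-m with n′ , refl ← m≤n⇒∃[o]m+o≡n 1≤n = begin-equality
    ∑[ i ← upTo (suc n′) ] f (suc i)
      ≡⟨ ∑-first n′ (f ∘ suc) ⟩
    f 1 + ∑[ i ← upTo n′ ] f (2 + i)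
      ≡⟨ cong₂ _+_ (term-mod f-m 0 1 first) (∑-cycle m⊥d a≡2 f-m (h * suc n + 2 * d) 2) ⟨
    f (term n h d 0) + ∑[ i ← upTo n′ ] f (h * suc n + 2 * d + i * d)
      ≡⟨ cong (λ s → f (term n h d 0) + s) (∑-cong-all (upTo n′) (λ i → cong f (shift (h * suc n) d i))) ⟩
    f (term n h d 0) + ∑[ i ← upTo n′ ] f (term n h d (suc i))
      ≡⟨ ∑-first n′ (f ∘ term n h d) ⟨
    ∑[ i ← upTo (suc n′) ] f (term n h d i) ∎
    where
    shift : ∀ x d i → x + 2 * d + i * d ≡ x + suc (suc i) * d
    shift = solve-∀
    identity : ∀ K N D → + 2 ℤ.* K ℤ.+ D ℤ.- + 1 ℤ.+ K ℤ.* (+ 1 ℤ.+ N ℤ.- + 2) ≡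
               K ℤ.* (+ 1 ℤ.+ N) ℤ.+ (+ 1 ℤ.+ + 0) ℤ.* D ℤ.- + 1
    identity = ℤSolver.solve-∀
    first : M Signed.∣ K ℤ.* (+ 1 ℤ.+ N) ℤ.+ (+ 1 ℤ.+ + 0) ℤ.* D ℤ.- + 1
    first = subst (M Signed.∣_) (trans (cong (λ x → x ℤ.+ D ℤ.- + 1 ℤ.+ K ℤ.* (+ 1 ℤ.+ N ℤ.- + 2)) (ℤ.pos-* 2 h))
      (identity K N D))
      (Signed.∣m∣n⇒∣m+n (signed (+ (2 * h + d) ℤ.- + 1) 2h+d≡1) (Signed.∣n⇒∣m*n K (signed (+ suc n ℤ.- + 2) a≡2)))
  -- The two sums agree term by term: ha + (i + 1)d ≡ i + 1.
  cases (inj₂ (inj₂ (inj₁ (d≡1 , h≡0)))) {f} f-m = ∑-cong-all (upTo n) λ i → sym (term-mod f-m i (suc i)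
    (subst (M Signed.∣_) (identity K N D (+ i))
      (Signed.∣m∣n⇒∣m+n (Signed.∣n⇒∣m*n (+ 1 ℤ.+ N) (signed (K ℤ.- + 0) h≡0))
                        (Signed.∣n⇒∣m*n (+ 1 ℤ.+ + i) (signed (D ℤ.- + 1) d≡1)))))
    where
    identity : ∀ K N D I → (+ 1 ℤ.+ N) ℤ.* (K ℤ.- + 0) ℤ.+ (+ 1 ℤ.+ I) ℤ.* (D ℤ.- + 1) ≡
               K ℤ.* (+ 1 ℤ.+ N) ℤ.+ (+ 1 ℤ.+ I) ℤ.* D ℤ.- (+ 1 ℤ.+ I)
    identity = ℤSolver.solve-∀
  -- Here ha + (i + 1)d ≡ a - (i + 1), so the progression runs through the interval backwards.
  cases (inj₂ (inj₂ (inj₂ (d≡-1 , h≡1)))) {f} f-m = ∑-reflect n λ j i 1+j+i≡n → sym (term-mod f-m i (suc j)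
    (subst (λ x → M Signed.∣ K ℤ.* (+ 1 ℤ.+ + x) ℤ.+ (+ 1 ℤ.+ + i) ℤ.* D ℤ.- (+ 1 ℤ.+ + j)) 1+j+i≡n
      (subst (M Signed.∣_) (identity K D (+ i) (+ j))
        (Signed.∣m∣n⇒∣m+n (Signed.∣n⇒∣m*n (+ 1 ℤ.+ (+ 1 ℤ.+ (+ j ℤ.+ + i))) (signed (K ℤ.- + 1) h≡1))
                          (Signed.∣n⇒∣m*n (+ 1 ℤ.+ + i) (signed (D ℤ.- (- (+ 1))) d≡-1))))))
    where
    identity : ∀ K D I J → (+ 1 ℤ.+ (+ 1 ℤ.+ (J ℤ.+ I))) ℤ.* (K ℤ.- + 1) ℤ.+ (+ 1 ℤ.+ I) ℤ.* (D ℤ.- (- (+ 1))) ≡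
               K ℤ.* (+ 1 ℤ.+ (+ 1 ℤ.+ (J ℤ.+ I))) ℤ.+ (+ 1 ℤ.+ I) ℤ.* D ℤ.- (+ 1 ℤ.+ J)
    identity = ℤSolver.solve-∀

-- Semigroups with an arithmetic Apéry set

⟨⟩-least : (S : NumericalSemigroup) {G : ℕ → Set} → (∀ {x} → G x → member S x) →
           ∀ {s} → ⟨ G ⟩ s → member S s
⟨⟩-least S {G} G⊆S (cs , all , refl) = closed cs all
  where
  closed : ∀ cs → All (G ∘ proj₂) cs → member S (sum (map (uncurry _*_) cs))
  closed []             []       = 0∈ S
  closed ((c , x) ∷ cs) (x∈ ∷ all) = +-closed S (*-closed S {1} c (G⊆S x∈)) (closed cs all)

⟨⟩-+ˡ : ∀ {G : ℕ → Set} {x s} → G x → ⟨ G ⟩ s → ⟨ G ⟩ (x + s)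
⟨⟩-+ˡ {x = x} x∈ (cs , all , refl) =
  (1 , x) ∷ cs , x∈ ∷ all , cong (_+ sum (map (uncurry _*_) cs)) (*-identityˡ x)

Ap-or-descend : (S : NumericalSemigroup) {a s : ℕ} → member S s →
                s ∈ Ap S a ⊎ (∃[ t ] member S t × t + a ≡ s)
Ap-or-descend S {a} {s} s∈S with a ≤? s
... | no  a≰s = inj₁ (Ap⁺ S s∈S λ t t+a≡s _ → a≰s (subst (a ≤_) t+a≡s (m≤n+m a t)))
... | yes a≤s with member? S (s ∸ a)
...   | yes s-a∈S = inj₂ (s ∸ a , s-a∈S , m∸n+n≡m a≤s)
...   | no  s-a∉S = inj₁ (Ap⁺ S s∈S λ t t+a≡s t∈S →
        s-a∉S (subst (member S) (trans (sym (m+n∸n≡m t a)) (cong (_∸ a) t+a≡s)) t∈S))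

-- Subtracting a as long as the result stays in S ends in the Apéry set, at 0 or at a generator.
⟨⟩-apery : (S : NumericalSemigroup) {a : ℕ} .{{_ : NonZero a}} {G : ℕ → Set} → G a →
           (∀ {x} → x ∈ Ap∖0 S a → G x) → ∀ {s} → member S s → ⟨ G ⟩ s
⟨⟩-apery S {a} {G} a∈G ap⊆G {s} = <-rec (λ s → member S s → ⟨ G ⟩ s) generate s
  where
  generate : ∀ s → (∀ {r} → r < s → member S r → ⟨ G ⟩ r) → member S s → ⟨ G ⟩ s
  generate zero      rec _   = [] , [] , refl
  generate s@(suc _) rec s∈S with Ap-or-descend S {a} s∈S
  ... | inj₁ s∈Ap = subst ⟨ G ⟩ (+-identityʳ s) (⟨⟩-+ˡ (ap⊆G (s∈Ap , λ ())) ([] , [] , refl))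
  ... | inj₂ (t , t∈S , t+a≡s) = subst ⟨ G ⟩ (trans (+-comm a t) t+a≡s)
    (⟨⟩-+ˡ a∈G (rec (subst (t <_) t+a≡s (m<m+n t (>-nonZero⁻¹ a))) t∈S))

module _ (S : NumericalSemigroup) {n : ℕ} (a∈S : member S (suc n)) (1≤n : 1 ≤ n)
         {β : ℤ} {d : ℕ} .{{_ : NonZero d}}
         (apery≐ : embed (Ap∖0 S (suc n)) ≐ progression β d (suc n))
         (a≡2⇒ : suc n ≡ 2 → β ≡ + 0 × Odd d) where

  private
    a : ℕ
    a = suc n

  apery-term : ∀ {i} → i < n → ∃[ s ] Ap∖0 S a s × + s ≡ β ℤ.+ + (suc i * d)
  apery-term {i} i<n with s , s∈Ap , eq ← proj₂ apery≐ (suc i , s≤s z≤n , s≤s i<n , refl) =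
    s , s∈Ap , sym eq

  -- The term β + d serves as base point in ℕ, since β itself might so far be negative.
  s₀ : ℕ
  s₀ = proj₁ (apery-term 1≤n)

  s₀∈S : member S s₀
  s₀∈S = proj₁ (proj₁ (proj₁ (proj₂ (apery-term 1≤n))))

  s₀≡β+d : + s₀ ≡ β ℤ.+ + d
  s₀≡β+d = trans (proj₂ (proj₂ (apery-term 1≤n))) (cong (λ x → β ℤ.+ + x) (*-identityˡ d))

  s₀+id∈Ap : ∀ {i} → i < n → Ap∖0 S a (s₀ + i * d)
  s₀+id∈Ap {i} i<n with s , s∈Ap , s≡ ← apery-term i<n = subst (Ap∖0 S a) (ℤ.+-injective s≡s₀+id) s∈Ap
    where
    s≡s₀+id : + s ≡ + (s₀ + i * d)
    s≡s₀+id = trans s≡ (trans (sym (ℤ.+-assoc β (+ d) (+ (i * d)))) (cong (ℤ._+ + (i * d)) (sym s₀≡β+d)))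

  -- Contradictions below arise by rewriting a term as t + a with t visibly in S.
  apery-minimal : ∀ {i t} → i < n → s₀ + i * d ≡ t + a → ¬ member S t
  apery-minimal i<n eq = Ap⁻ S (subst (Ap S a) eq (proj₁ (s₀+id∈Ap i<n)))

  private
    2≤n : n ≢ 1 → 2 ≤ n
    2≤n n≢1 = ≤∧≢⇒< 1≤n (n≢1 ∘ sym)

  a⊥d : gcd a d ≡ 1
  a⊥d with n ≟ 1
  -- For a = 2 the coprimality is the oddness of d imposed by the normalisation.
  ... | yes refl = ∣1⇒≡1 (∣m+n∣m⇒∣n (subst (gcd 2 d ∣_) d≡2q+1 (gcd[m,n]∣n 2 d))
                                     (∣n⇒∣m*n (d / 2) (gcd[m,n]∣m 2 d)))
    where
    d≡2q+1 : d ≡ d / 2 * 2 + 1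
    d≡2q+1 = trans (m≡m%n+[m/n]*n d 2) (trans (cong (_+ d / 2 * 2) (proj₂ (a≡2⇒ refl))) (+-comm 1 _))
  ... | no n≢1 with gcd a d ≟ 1
  ...   | yes g≡1 = g≡1
  ...   | no  g≢1 = repeat (gcd[m,n]∣m a d) (gcd[m,n]∣n a d)
    where
    -- With g = gcd(a, d) > 1 two terms of the progression, a/g apart, agree
    -- modulo a.
    repeat : gcd a d ∣ a → gcd a d ∣ d → gcd a d ≡ 1
    repeat (divides k a≡kg) (divides zero d≡0) = contradiction d≡0 (≢-nonZero⁻¹ d)
    repeat (divides k a≡kg) (divides (suc l) d≡lg) = contradiction
      (+-closed S s₀∈S (*-closed S {a} l a∈S))
      (apery-minimal (k<n k a≡kg) (begin-equality
        s₀ + k * d                    ≡⟨ cong (λ x → s₀ + k * x) d≡lg ⟩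
        s₀ + k * (suc l * gcd a d)    ≡⟨ rearrange s₀ k l (gcd a d) ⟩
        s₀ + l * (k * gcd a d) + k * gcd a d  ≡⟨ cong (λ x → s₀ + l * x + x) a≡kg ⟨
        s₀ + l * a + a                ∎))
      where
      rearrange : ∀ s k l g → s + k * (suc l * g) ≡ s + l * (k * g) + k * g
      rearrange = solve-∀

      g≥2 : 2 ≤ gcd a d
      g≥2 = ≤∧≢⇒< (n≢0⇒n>0 (gcd[m,n]≢0 a d (inj₁ λ ()))) (g≢1 ∘ sym)

      -- The index k = a / g must still belong to the progression, that is, k ≤ a - 2. For k ≥ 2
      -- this follows from 2 + k ≤ 2k ≤ a.
      k<n : ∀ k → a ≡ k * gcd a d → k < n
      k<n 0 ()
      k<n 1 _ = 2≤n n≢1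
      k<n k@(suc (suc k′)) a≡kg = ≤-pred (begin
        2 + k            ≤⟨ +-monoˡ-≤ k (s≤s (s≤s z≤n)) ⟩
        k + k            ≡⟨ double k ⟩
        k * 2            ≤⟨ *-monoʳ-≤ k g≥2 ⟩
        k * gcd a d      ≡⟨ a≡kg ⟨
        a                ∎)
        where
        double : ∀ k → k + k ≡ k * 2
        double = solve-∀

  -- Among the full residue system s₀ + i d (i < a) only the last member can
  -- be divisible by a, the others being positive elements of the Apéry set.
  a∣s₀+nd : a ∣ s₀ + n * d
  a∣s₀+nd = m%n≡0⇒n∣m (s₀ + n * d) a (1≤χ⇒≡ _ _ (≤-reflexive (sym (begin-equality
    f (s₀ + n * d)                                        ≡⟨ cong (_+ f (s₀ + n * d)) (∑-zero n (χ-≢ ∘ a∤)) ⟨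
    ∑[ i ← upTo n ] f (s₀ + i * d) + f (s₀ + n * d)       ≡⟨ ∑-last n (λ i → f (s₀ + i * d)) ⟨
    ∑[ i ← upTo a ] f (s₀ + i * d)
      ≡⟨ ∑-cycle a⊥d ∣-refl (mod-periodic a (λ x → χ x 0)) s₀ 0 ⟩
    ∑ (upTo a) f                                          ≡⟨ ∑-mod-χ a (s≤s z≤n) ⟩
    1                                                     ∎))))
    where
    f : ℕ → ℕ
    f x = χ (x % a) 0

    a∤ : ∀ {i} → i < n → (s₀ + i * d) % a ≢ 0
    a∤ {i} i<n eq with m%n≡0⇒n∣m (s₀ + i * d) a eq
    ... | divides zero    s≡0 = proj₂ (s₀+id∈Ap i<n) (sym s≡0)
    ... | divides (suc q) s≡  = apery-minimal i<n (trans s≡ (+-comm a (q * a))) (*-closed S {a} q a∈S)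

  -- Since `s₀ + n * d` is β + ad, its divisibility by a passes to β, and h is the quotient less d.
  -- For n = 1 the normalisation gives β = 0.
  β≡ha : ∃[ h ] β ≡ + (h * a)
  β≡ha with n ≟ 1 | a∣s₀+nd
  ... | yes refl | _ = 0 , proj₁ (a≡2⇒ refl)
  ... | no  n≢1  | divides q s₀+nd≡qa with d ≤? q
  ...   | yes d≤q with h , refl ← m≤n⇒∃[o]m+o≡n d≤q = h , β≡ h s₀+nd≡qa
    where
    cancel : ∀ B D → B ≡ B ℤ.+ D ℤ.- D
    cancel = ℤSolver.solve-∀
    rearrange : ∀ d h n → (d + h) * suc n ≡ h * suc n + d + n * d
    rearrange = solve-∀
    β≡ : ∀ h → s₀ + n * d ≡ (d + h) * a → β ≡ + (h * a)
    β≡ h eq = trans (cancel β (+ d)) (trans (cong (ℤ._- + d) (trans (sym s₀≡β+d)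
      (cong +_ (+-cancelʳ-≡ (n * d) s₀ (h * a + d) (trans eq (rearrange d h n))))))
      (sym (cancel (+ (h * a)) (+ d))))
  -- A negative multiple is impossible: s₀ + s₀ would precede s₀ + d in its
  -- class modulo a.
  ...   | no  d≰q with k , 1+q+k≡d ← m≤n⇒∃[o]m+o≡n (≰⇒> d≰q) = contradiction
    (+-closed S (+-closed S s₀∈S s₀∈S) (*-closed S {a} k a∈S))
    (apery-minimal {1} (2≤n n≢1) (begin-equality
      s₀ + 1 * d                    ≡⟨ cong (λ x → s₀ + x) (trans (*-identityˡ d) (d≡ k 1+q+k≡d)) ⟩
      s₀ + (s₀ + suc k * a)         ≡⟨ rearrange s₀ k a ⟩
      s₀ + s₀ + k * a + a           ∎))
    where
    rearrange : ∀ s k a → s + (s + suc k * a) ≡ s + s + k * a + a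
    rearrange = solve-∀
    d≡ : ∀ k → suc q + k ≡ d → d ≡ s₀ + suc k * a
    d≡ k eq = +-cancelʳ-≡ (n * d) _ _ (begin-equality
      d + n * d                   ≡⟨ *-comm a d ⟩
      d * a                       ≡⟨ cong (_* a) eq ⟨
      (suc q + k) * a             ≡⟨ expand q k a ⟩
      q * a + suc k * a           ≡⟨ cong (_+ suc k * a) s₀+nd≡qa ⟨
      s₀ + n * d + suc k * a      ≡⟨ rotate s₀ (n * d) (suc k * a) ⟩
      s₀ + suc k * a + n * d      ∎)
      where
      expand : ∀ q k a → (suc q + k) * a ≡ q * a + suc k * a
      expand = solve-∀
      rotate : ∀ x y z → x + y + z ≡ x + z + y
      rotate = solve-∀

  module _ {h : ℕ} (β≡ : β ≡ + (h * a)) where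

    apery⇔ : ∀ {s} → s ∈ Ap∖0 S a ⇔ (∃[ i ] i < n × s ≡ term n h d i)
    apery⇔ {s} = mk⇔ ⊆ ⊇
      where
      ⊆ : s ∈ Ap∖0 S a → ∃[ i ] i < n × s ≡ term n h d i
      ⊆ s∈Ap with suc i , _ , s≤s i<n , s≡ ← proj₁ apery≐ (s , s∈Ap , refl) =
        i , i<n , ℤ.+-injective (trans s≡ (cong (ℤ._+ + (suc i * d)) β≡))

      ⊇ : ∃[ i ] i < n × s ≡ term n h d i → s ∈ Ap∖0 S a
      ⊇ (i , i<n , refl) with s′ , s′∈Ap , s′≡ ← apery-term i<n =
        subst (Ap∖0 S a) (ℤ.+-injective (trans s′≡ (cong (ℤ._+ + (suc i * d)) β≡))) s′∈Ap

    n≡1⇒h≡0 : n ≡ 1 → h ≡ 0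
    n≡1⇒h≡0 n≡1 = *-cancelʳ-≡ h 0 a (ℤ.+-injective (trans (sym β≡) (proj₁ (a≡2⇒ (cong suc n≡1)))))

-- Generators and the equidistribution criterion

module _ (S : NumericalSemigroup) {n : ℕ} (a∈S : member S (suc n))
         {h d : ℕ} .{{_ : NonZero d}}
         (apery : ∀ {s} → s ∈ Ap∖0 S (suc n) ⇔ (∃[ i ] i < n × s ≡ term n h d i)) where

  private
    a : ℕ
    a = suc n

  member≐⟨generators⟩ : member S ≐ ⟨ generators a h d ⟩
  member≐⟨generators⟩ = ⟨⟩-apery S (inj₁ refl) ap⊆G , ⟨⟩-least S G⊆S
    where
    ap⊆G : ∀ {x} → x ∈ Ap∖0 S a → generators a h d x
    ap⊆G x∈Ap with i , i<n , x≡ ← to apery x∈Ap = inj₂ (suc i , s≤s z≤n , s≤s i<n , x≡)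

    G⊆S : ∀ {x} → generators a h d x → member S x
    G⊆S (inj₁ refl) = a∈S
    G⊆S (inj₂ (suc i , _ , s≤s i<n , x≡)) = proj₁ (proj₁ (from apery (i , i<n , x≡)))

  equidistributed⇔ : 1 ≤ n → (n ≡ 1 → h ≡ 0) → gcd a d ≡ 1 →
    (m : ℕ) .{{_ : NonZero m}} → H S ≢ [] →
    Equidistributed m (H S) ⇔ (gcd (a * d) m ≡ 1 × Congruences n h d m)
  equidistributed⇔ 1≤n n≡1⇒h≡0 a⊥d m@(suc _) H≢[] = mk⇔ ⇒ ⇐
    where
    ⇒ : Equidistributed m (H S) → gcd (a * d) m ≡ 1 × Congruences n h d m
    ⇒ equi = gcd-*ˡ {a} {d} {m} a⊥m d⊥m , AperyMod⇒congruences {n} {h} {d} a⊥m d⊥m apery-m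
      where
      a⊥m : gcd a m ≡ 1
      a⊥m = equidistributed⇒coprime-a S a∈S {h} {d} apery m a⊥d H≢[] equi
      apery-m : AperyMod n h d m
      apery-m = equidistributed⇒AperyMod S a∈S {h} {d} apery m equi
      d⊥m : gcd d m ≡ 1
      d⊥m = AperyMod⇒coprime-d {n} {h} {d} 1≤n n≡1⇒h≡0 apery-m

    ⇐ : gcd (a * d) m ≡ 1 × Congruences n h d m → Equidistributed m (H S)
    ⇐ (ad⊥m , congruences) = AperyMod⇒equidistributed S a∈S {h} {d} apery m
      (gcd-∣ˡ {a} (∣m⇒∣m*n d ∣-refl) ad⊥m)
      (congruences⇒AperyMod {n} {h} {d} 1≤n (gcd-∣ˡ {d} (n∣m*n a) ad⊥m) congruences)

corollary5p6 : (S : NumericalSemigroup) (a : ℕ) → a ∈ member S → a ≢ 0 →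
    (m : ℕ) .{{_ : NonZero m}} →
    (β : ℤ) (δ : ℕ) → IsArithmetic S a β δ → Satisfiable (Ap∖0 S a) →
    ∃[ h ] ∃[ d ]
    (β ≡ + (h * a) × δ ≡ d) ×
    (2 ≤ a × 1 ≤ d × gcd a d ≡ 1 × (a ≡ 2 → h ≡ 0 × Odd d)) ×
    member S ≐ ⟨ generators a h d ⟩ ×
    (H S ≢ [] →
    (Equidistributed m (H S) ⇔
    (gcd (a * d) m ≡ 1 ×
    (+ a ≡ + 1 [mod m ]
    ⊎ (+ a ≡ + 2 [mod m ] × + (2 * h + d) ≡ + 1 [mod m ])
    ⊎ (+ d ≡ + 1 [mod m ] × + h ≡ + 0 [mod m ])
    ⊎ (+ d ≡ - (+ 1) [mod m ] × + h ≡ + 1 [mod m ])))))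
corollary5p6 S zero    a∈S a≢0 m β δ _ _ = contradiction refl a≢0
corollary5p6 S (suc n) a∈S a≢0 m β δ (1≤δ , apery≐ , a≡2⇒) (s , s∈Ap)
  -- Nonemptiness enters here: a term has an index with 1 ≤ i < a, whence a ≥ 2.
  with suc i , _ , s≤s i<n , _ ← proj₁ apery≐ (s , s∈Ap , refl) = conclude (≤-trans (s≤s z≤n) i<n)
  where
  instance
    δ-nonZero : NonZero δ
    δ-nonZero = >-nonZero 1≤δ

  conclude : 1 ≤ n → _
  conclude 1≤n with h , β≡ ← β≡ha S a∈S 1≤n apery≐ a≡2⇒ =
    h , δ , (β≡ , refl) ,
    (s≤s 1≤n , 1≤δ , a⊥δ , λ a≡2 → n≡1⇒h≡0′ (suc-injective a≡2) , proj₂ (a≡2⇒ a≡2)) ,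
    member≐⟨generators⟩ S a∈S {h} terms ,
    equidistributed⇔ S a∈S {h} terms 1≤n n≡1⇒h≡0′ a⊥δ m
    where
    a⊥δ : gcd (suc n) δ ≡ 1
    a⊥δ = a⊥d S a∈S 1≤n apery≐ a≡2⇒
    terms : ∀ {s} → s ∈ Ap∖0 S (suc n) ⇔ (∃[ i ] i < n × s ≡ term n h δ i)
    terms = apery⇔ S a∈S 1≤n apery≐ a≡2⇒ {h} β≡
    n≡1⇒h≡0′ : n ≡ 1 → h ≡ 0
    n≡1⇒h≡0′ = n≡1⇒h≡0 S a∈S 1≤n apery≐ a≡2⇒ {h} β≡
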